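{- For every integer $n\ge 0$, \[ B_{n,q}=\sum_{k=0}^{n}(-1)^k2^{n-2k}k!\,S_2(n,k)\,d_{k,q}. \]
   Context: Let $p$ be a fixed odd prime, $\mathbb{C}_p$ the completion of the algebraic closure of $\mathbb{Q}_p$, with $|p|_p=1/p$. Let $q\in\mathbb{C}_p$ with $|1-q|_p<p^{ -1/(p-1)}$, and $\log$ the $p$-adic logarithm. The $q$-Bernoulli numbers $B_{n,q}$ are defined by $\frac{(q-1)+\frac{q-1}{\log q}t}{qe^t-1}=\sum_{n\ge0}B_{n,q}\frac{t^n}{n!}$. The numbers $d_{n,q}$ are defined by \[ \frac{q-1+\frac{q-1}{\log q}\cdot\frac12\log(1-4t)}{q\sqrt{1-4t}-1}=\sum_{n=0}^{\infty}d_{n,q}t^n, \] for $t\in\mathbb{C}_p$ with $|t|_p<p^{ -1/(p-1)}$. $S_2(n,k)$ are the Stirling numbers of the second kind, defined by $x^n=\sum_{l=0}^n S_2(n,l)(x)_l$, where $(x)_0=1$, $(x)_l=x(x-1)\cdots(x-l+1)$. -}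

module Defs where

open import Algebra.Apartness using (HeytingField; HeytingCommutativeRing)
open import Algebra.Bundles using (CommutativeRing)
open import Algebra.Morphism.Structures using (IsRingHomomorphism)
import Algebra.Properties.Semiring.Exp as Exp
import Algebra.Properties.Semiring.Sum as Sum
open import Data.Fin.Base using (Fin; toℕ)
open import Data.Integer.Base as ℤ using (ℤ; +_; -[1+_]; -1ℤ)
open import Data.Nat.Base as ℕ using (ℕ; zero; suc; NonZero; NonTrivial; _!)
import Data.Nat.Properties as ℕ
open import Data.Nat.Divisibility using (_∤_)
open import Data.Nat.Primality using (Prime; prime)
open import Data.Product.Base using (∃-syntax; _×_)
open import Data.Rational.Base as ℚ using (ℚ; 0ℚ; 1ℚ; ½)
import Data.Rational.Properties as ℚ
open import Function.Base using (_∘_)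
open import Function.Bundles using (_⇔_)
open import Level using (Level; 0ℓ; _⊔_) renaming (suc to lsuc)
open import Relation.Binary.Construct.Add.Supremum.NonStrict ℚ._≤_ using (_≤⁺_)
open import Relation.Binary.Construct.Add.Supremum.Strict ℚ._<_ using (_<⁺_)
open import Relation.Binary.PropositionalEquality.Core using (_≡_)
open import Relation.Nullary.Construct.Add.Supremum using (_⁺; [_]; ⊤⁺)

private
  variable
    c ℓ₁ ℓ₂ c′ ℓ₁′ ℓ₂′ : Level

------------------------------------------------------------------------
-- Rational constants

module ℚ-Ops where
  open CommutativeRing ℚ.+-*-commutativeRing public using (semiring)
  open Exp semiring public using (_^_)
  open Sum semiring public using (sum-syntax; sum⁺-syntax)

fromℤ : ℤ → ℚ
fromℤ i = i ℚ./ 1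

1/_! : ℕ → ℚ
1/ n ! = (+ 1 ℚ./ n !) {{n ℕ.!≢0}}

2^_ : ℤ → ℚ
2^ (+ n)    = fromℤ (+ 2) ℚ-Ops.^ n
2^ -[1+ n ] = ½ ℚ-Ops.^ suc n

fallingFactorial : ℚ → ℕ → ℚ
fallingFactorial x zero    = 1ℚ
fallingFactorial x (suc l) = fallingFactorial x l ℚ.* (x ℚ.- fromℤ (+ l))

-- Coefficients of log (1 + x).
logCoeff : ℕ → ℚ
logCoeff zero    = 0ℚ
logCoeff (suc n) = (-1ℤ ℤ.^ n) ℚ./ suc n

-- Coefficients of √(1 + x), i.e. the binomial coefficients of exponent 1/2.
sqrtCoeff : ℕ → ℚ
sqrtCoeff n = fallingFactorial ½ n ℚ.* 1/ n !

-- Both sides are polynomials in x, so letting x range over ℚ is the same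
-- as an identity in an indeterminate.
IsStirling₂ : (ℕ → ℕ → ℤ) → Set
IsStirling₂ S = ∀ n x →
  x ^ n ≡ ∑[ l ≤ n ] (fromℤ (S n (toℕ l)) ℚ.* fallingFactorial x (toℕ l))
  where open ℚ-Ops

------------------------------------------------------------------------
-- Valued fields

infixl 6 _+⁺_

_+⁺_ : ℚ ⁺ → ℚ ⁺ → ℚ ⁺
[ r ] +⁺ [ s ] = [ r ℚ.+ s ]
[ r ] +⁺ ⊤⁺    = ⊤⁺
⊤⁺    +⁺ s     = ⊤⁺

module FieldOps (K : HeytingField c ℓ₁ ℓ₂) where
  open HeytingField K public
  open HeytingCommutativeRing heytingCommutativeRing public using (commutativeRing)
  open CommutativeRing commutativeRing public using (semiring; rawRing)
  open Exp semiring public using (_^_)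
  open Sum semiring public using (sum-syntax; sum⁺-syntax)

  -- z = x / y, which presupposes that y is nonzero.
  IsQuotient : Carrier → Carrier → Carrier → Set (ℓ₁ ⊔ ℓ₂)
  IsQuotient x y z = y # 0# × z * y ≈ x

-- All absolute values below are powers of p with rational exponent (or zero),
-- so they are written additively: |x| = p ^ (- v x), and |0| = 0 is v 0 = ⊤⁺.
record Valuation (K : HeytingField c ℓ₁ ℓ₂) : Set (c ⊔ ℓ₁ ⊔ ℓ₂) where
  open FieldOps K
  field
    v      : Carrier → ℚ ⁺
    v-cong : ∀ {x y} → x ≈ y → v x ≡ v y
    v-#0   : ∀ x → x # 0# ⇔ (∃[ r ] v x ≡ [ r ])
    v-*    : ∀ x y → v (x * y) ≡ v x +⁺ v y
    v-+    : ∀ r x y → r ≤⁺ v x → r ≤⁺ v y → r ≤⁺ v (x + y)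

record ValuedField c ℓ₁ ℓ₂ : Set (lsuc (c ⊔ ℓ₁ ⊔ ℓ₂)) where
  field
    heytingField : HeytingField c ℓ₁ ℓ₂
    valuation    : Valuation heytingField

  open FieldOps heytingField public
  open Valuation valuation public

  _⟶_ : (ℕ → Carrier) → Carrier → Set
  a ⟶ x = ∀ r → ∃[ N ] ∀ n → N ℕ.≤ n → [ r ] ≤⁺ v (a n - x)

  IsCauchy : (ℕ → Carrier) → Set
  IsCauchy a = ∀ r → ∃[ N ] ∀ m n → N ℕ.≤ m → N ℕ.≤ n → [ r ] ≤⁺ v (a m - a n)

  IsSum : (ℕ → Carrier) → Carrier → Set
  IsSum a x = (λ n → ∑[ i < n ] a (toℕ i)) ⟶ x

record Extension (K : ValuedField c ℓ₁ ℓ₂) (L : ValuedField c′ ℓ₁′ ℓ₂′) :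
                 Set (c ⊔ ℓ₁ ⊔ ℓ₂ ⊔ c′ ⊔ ℓ₁′ ⊔ ℓ₂′) where
  private
    module K = ValuedField K
    module L = ValuedField L
  field
    ι                  : K.Carrier → L.Carrier
    isRingHomomorphism : IsRingHomomorphism K.rawRing L.rawRing ι
    v-ι                : ∀ x → L.v (ι x) ≡ K.v x

record Completion (K : ValuedField c ℓ₁ ℓ₂) (L : ValuedField c′ ℓ₁′ ℓ₂′) :
                  Set (c ⊔ ℓ₁ ⊔ ℓ₂ ⊔ c′ ⊔ ℓ₁′ ⊔ ℓ₂′) where
  private
    module K = ValuedField K
    module L = ValuedField L
  field
    extension : Extension K L
  open Extension extension public
  field
    dense    : ∀ y r → ∃[ x ] [ r ] ≤⁺ L.v (ι x L.- y)
    complete : ∀ a → L.IsCauchy a → ∃[ y ] a L.⟶ y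

record AlgebraicClosure (K : ValuedField c ℓ₁ ℓ₂) (L : ValuedField c′ ℓ₁′ ℓ₂′) :
                        Set (c ⊔ ℓ₁ ⊔ ℓ₂ ⊔ c′ ⊔ ℓ₁′ ⊔ ℓ₂′) where
  private
    module K = ValuedField K
  open ValuedField L

  -- y is a root of the monic polynomial of degree n + 1 with lower
  -- coefficients a.
  IsRoot : ∀ n → (Fin (suc n) → Carrier) → Carrier → Set ℓ₁′
  IsRoot n a y = y ^ suc n + ∑[ i ≤ n ] (a i * y ^ toℕ i) ≈ 0#

  field
    extension : Extension K L
  open Extension extension public
  field
    algebraic           : ∀ y → ∃[ n ] ∃[ a ] IsRoot n (ι ∘ a) y
    algebraicallyClosed : ∀ n a → ∃[ y ] IsRoot n a y

------------------------------------------------------------------------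
-- The field ℂₚ

-- The normalisation |p| = 1/p is the case k = m = 1 of v-ℕ below.
record PAdicValuation (p : ℕ) : Set where
  field
    valuation : Valuation ℚ.heytingField
  open Valuation valuation public
  field
    v-ℕ : ∀ k m → p ∤ m → v (fromℤ (+ (p ℕ.^ k ℕ.* m))) ≡ [ fromℤ (+ k) ]

  ℚ-valued : ValuedField 0ℓ 0ℓ 0ℓ
  ℚ-valued = record { heytingField = ℚ.heytingField ; valuation = valuation }

-- The tower ℚ ⊂ ℚₚ ⊂ ℚₚᵃ ⊂ ℂₚ; it determines ℂₚ up to isometric isomorphism.
record PAdicComplexNumbers (p : ℕ) c ℓ₁ ℓ₂ : Set (lsuc (c ⊔ ℓ₁ ⊔ ℓ₂)) where
  field
    pAdicValuation : PAdicValuation p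
    ℚₚ ℚₚᵃ ℂₚ      : ValuedField c ℓ₁ ℓ₂

  private
    module vₚ = PAdicValuation pAdicValuation

  field
    ℚₚ-completion  : Completion vₚ.ℚ-valued ℚₚ
    ℚₚᵃ-closure    : AlgebraicClosure ℚₚ ℚₚᵃ
    ℂₚ-completion  : Completion ℚₚᵃ ℂₚ

  fromℚ : ℚ → ValuedField.Carrier ℂₚ
  fromℚ = Completion.ι ℂₚ-completion ∘ AlgebraicClosure.ι ℚₚᵃ-closure
        ∘ Completion.ι ℚₚ-completion

------------------------------------------------------------------------
-- p-adic functions and the two families of numbers

private
  p∸1≢0 : ∀ p → .{{NonTrivial p}} → NonZero (p ℕ.∸ 1)
  p∸1≢0 p = ℕ.>-nonZero (ℕ.m<n⇒0<n∸m (ℕ.nonTrivial⇒n>1 p))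

1/[p-1] : ∀ {p} → Prime p → ℚ
1/[p-1] {p} (prime _) = (+ 1 ℚ./ (p ℕ.∸ 1)) {{p∸1≢0 p}}

module PAdicAnalysis {p : ℕ} (pPrime : Prime p)
                     (cp : PAdicComplexNumbers p c ℓ₁ ℓ₂) where

  open PAdicComplexNumbers cp public using (ℂₚ; fromℚ)
  open ValuedField ℂₚ public

  -- |x| < p ^ (- 1/(p-1))
  InDisc : Carrier → Set
  InDisc x = [ 1/[p-1] pPrime ] <⁺ v x

  IsExp : Carrier → Carrier → Set
  IsExp x y = IsSum (λ n → fromℚ (1/ n !) * x ^ n) y

  IsLog : Carrier → Carrier → Set
  IsLog x y = IsSum (λ n → fromℚ (logCoeff n) * (x - 1#) ^ n) y

  -- The principal square root: the one close to 1, given by the binomial series.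
  IsSqrt : Carrier → Carrier → Set
  IsSqrt x y = IsSum (λ n → fromℚ (sqrtCoeff n) * (x - 1#) ^ n) y

  -- Both generating functions have a removable singularity in the disc (for
  -- qBernoulli at t = - log q), where the quotient reads 0 / 0; the expansion
  -- is required at the points where the quotient is defined.

  IsqBernoulli : Carrier → (ℕ → Carrier) → Set (c ⊔ ℓ₁ ⊔ ℓ₂)
  IsqBernoulli q B =
    ∃[ logq ] IsLog q logq ×
    ∃[ s ] IsQuotient (q - 1#) logq s ×
    (∀ t → InDisc t →
      ∃[ eᵗ ] IsExp t eᵗ ×
      (∀ z → IsQuotient ((q - 1#) + s * t) (q * eᵗ - 1#) z →
             IsSum (λ n → B n * (fromℚ (1/ n !) * t ^ n)) z))

  IsdNumbers : Carrier → (ℕ → Carrier) → Set (c ⊔ ℓ₁ ⊔ ℓ₂)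
  IsdNumbers q d =
    ∃[ logq ] IsLog q logq ×
    ∃[ s ] IsQuotient (q - 1#) logq s ×
    (∀ t → InDisc t →
      let 1-4t = 1# - fromℚ (fromℤ (+ 4)) * t in
      ∃[ log[1-4t] ] IsLog 1-4t log[1-4t] ×
      ∃[ √[1-4t] ] IsSqrt 1-4t √[1-4t] ×
      (∀ z → IsQuotient ((q - 1#) + s * (fromℚ ½ * log[1-4t])) (q * √[1-4t] - 1#) z →
             IsSum (λ n → d n * t ^ n) z))

{-# OPTIONS --safe #-}
module Submission where

-- In the variable x with 1 + x = 1 - 4t = e²ᵘ the generating function of the
-- d's becomes, as a function of u, that of the B's: half the logarithm becomes
-- u and the square root becomes eᵘ. Substituting x = e²ᵘ - 1 in a series f(x)
-- gives Σ (Lⁿ f)(0) uⁿ/n! for the derivation L = 2 (1 + x) d/dx, so composition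
-- of series is replaced by iteration of L. Both families of numbers then
-- satisfy q Σₖ C(n,k) bₖ = rₙ + bₙ with the same r, which determines b since
-- q ≠ 1, and the coefficients of Lⁿ at 0 are 2ⁿ k! S₂(n,k).
--
-- To pass from the p-adic functions to identities of formal series, only
-- their asymptotic expansions along the points p^m, p^(m+1), … are used:
-- these are unique, multiplicative, and computed by convergent power series.

open import Defs
import Algebra.Apartness.Properties.HeytingCommutativeRing as HeytingProperties
open import Algebra.Bundles using (CommutativeRing)
import Algebra.Morphism.Construct.Composition as Composition
open import Algebra.Morphism.Structures using (IsRingHomomorphism)
import Algebra.Properties.AbelianGroup as AbelianGroupProperties
import Algebra.Properties.CommutativeSemiring.Exp as CommutativeExp
import Algebra.Properties.Ring as RingProperties
import Algebra.Properties.Semiring.Exp as Exp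
import Algebra.Properties.Semiring.Mult as Mult
import Algebra.Properties.Semiring.Sum as Sum
import Algebra.Solver.Ring.NaturalCoefficients.Default as Solver
open import Data.Fin.Base using (toℕ)
import Data.Fin.Properties as Fin
open import Data.Integer.Base as ℤ using (ℤ; +_; -[1+_]; -1ℤ; _⊖_)
import Data.Integer.Properties as ℤ
open import Data.Nat.Base as ℕ using (ℕ; zero; suc; z≤n; s≤s; _!)
open import Data.Nat.Divisibility using (_∤_; ∣1⇒≡1)
open import Data.Nat.GeneralisedArithmetic using (iterate)
open import Data.Nat.Induction using (<-rec)
open import Data.Nat.Primality using (Prime; prime; ¬prime[0]; ¬prime[1])
import Data.Nat.Properties as ℕ
open import Data.Product.Base as Product using (∃-syntax; _,_; proj₁; proj₂)
open import Data.Rational.Base as ℚ using (ℚ; 0ℚ; 1ℚ; ½; toℚᵘ)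
import Data.Rational.Properties as ℚ
import Data.Rational.Solver as ℚSolver
open import Data.Rational.Unnormalised.Base as ℚᵘ using (mkℚᵘ; *≡*; *≤*; *<*)
import Data.Rational.Unnormalised.Properties as ℚᵘ
open import Data.Sum.Base using (_⊎_; inj₁; inj₂)
open import Function.Base using (_∘_)
open import Function.Bundles using (module Equivalence)
open import Level using (_⊔_; Lift; lift)
open import Relation.Binary.Construct.Add.Supremum.NonStrict ℚ._≤_ using (_≤⁺_; [_]; _≤⊤⁺; ≤⁺-trans; [≤]-injective)
open import Relation.Binary.Construct.Add.Supremum.Strict ℚ._<_ using (_<⁺_; [_]; [_]<⊤⁺)
open import Relation.Binary.PropositionalEquality as ≡ using (_≡_; _≢_)
import Relation.Binary.Reasoning.Setoid as SetoidReasoning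
open import Relation.Nullary.Construct.Add.Supremum using ([_]; ⊤⁺; []-injective)
open import Relation.Nullary.Negation using (contradiction; ¬_)

-- Clearing the denominator of a generating function at a point `t` gives an equation between
-- values. Turning it into one between coefficients would ordinarily take products of convergent
-- series and an identity theorem, hence rearrangements of double sums. A finite expansion with
-- bounded remainder avoids both: a product involves only finitely many coefficients, and uniqueness
-- needs only points tending to 0. It also tolerates discarding the finitely many points of the
-- sequence at which the denominator may vanish; at `t = 0` the denominator is `q - 1`, which is
-- nonzero because `log q` is.
--
-- The constants of the formula have two sources. Iterating `L` contributes `2ⁿ k! S₂(n,k)`. The d's
-- are coefficients in `t = -x/4`, so in the variable `x` they carry `(-1/4)ᵏ`, and
-- `2ⁿ (-1/4)ᵏ = (-1)ᵏ 2ⁿ⁻²ᵏ`.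

module PowerSeries {c ℓ} (R : CommutativeRing c ℓ) where
  open CommutativeRing R
  open Exp semiring public using (_^_)
  open Mult semiring using (_×_; ×-congʳ; ×-comm-*; ×-assoc-*)
  open Sum semiring using (sum-syntax; sum-cong-≋; ∑-distrib-+; sum-init-last; *-distribˡ-sum)
  open AbelianGroupProperties +-abelianGroup using () renaming (∙-cancelʳ to +-cancelʳ)
  open Solver commutativeSemiring using (solve; _:+_; _:*_; _:=_; con)
  open SetoidReasoning setoid

  -- Formal power series and the Cauchy product

  Series : Set c
  Series = ℕ → Carrier

  infix  4 _≋_
  infixl 6 _⊕_
  infixl 7 _⊛_ _·_

  _≋_ : Series → Series → Set ℓ
  f ≋ g = ∀ n → f n ≈ g n

  shift : Series → Series
  shift f n = f (suc n)

  _⊕_ : Series → Series → Series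
  (f ⊕ g) n = f n + g n

  _·_ : Carrier → Series → Series
  (a · f) n = a * f n

  -- The Cauchy product, by recursion on f = f₀ + x (shift f).
  _⊛_ : Series → Series → Series
  (f ⊛ g) zero    = f 0 * g 0
  (f ⊛ g) (suc n) = f 0 * g (suc n) + (shift f ⊛ g) n

  -- The substitution of `a x` for `x`.
  rescale : Carrier → Series → Series
  rescale a f n = a ^ n * f n

  δ : Series
  δ zero    = 1#
  δ (suc _) = 0#

  X : Series
  X zero    = 0#
  X (suc n) = δ n

  ⊛-cong : ∀ {f f′ g g′} → f ≋ f′ → g ≋ g′ → f ⊛ g ≋ f′ ⊛ g′
  ⊛-cong p q zero    = *-cong (p 0) (q 0)
  ⊛-cong p q (suc n) = +-cong (*-cong (p 0) (q (suc n))) (⊛-cong (p ∘ suc) q n)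

  ⊛-distribˡ-⊕ : ∀ f g h → f ⊛ (g ⊕ h) ≋ f ⊛ g ⊕ f ⊛ h
  ⊛-distribˡ-⊕ f g h zero    = distribˡ _ _ _
  ⊛-distribˡ-⊕ f g h (suc n) = trans (+-congˡ (⊛-distribˡ-⊕ (shift f) g h n))
    (solve 5 (λ a b c d e → a :* (b :+ c) :+ (d :+ e) := (a :* b :+ d) :+ (a :* c :+ e)) refl
      (f 0) (g (suc n)) (h (suc n)) ((shift f ⊛ g) n) ((shift f ⊛ h) n))

  ⊛-distribʳ-⊕ : ∀ h f g → (f ⊕ g) ⊛ h ≋ f ⊛ h ⊕ g ⊛ h
  ⊛-distribʳ-⊕ h f g zero    = distribʳ _ _ _
  ⊛-distribʳ-⊕ h f g (suc n) = trans (+-congˡ (⊛-distribʳ-⊕ h (shift f) (shift g) n))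
    (solve 5 (λ a b c d e → (a :+ b) :* c :+ (d :+ e) := (a :* c :+ d) :+ (b :* c :+ e)) refl
      (f 0) (g 0) (h (suc n)) ((shift f ⊛ h) n) ((shift g ⊛ h) n))

  ·-⊛ : ∀ a f g → (a · f) ⊛ g ≋ a · (f ⊛ g)
  ·-⊛ a f g zero    = *-assoc _ _ _
  ·-⊛ a f g (suc n) = trans (+-congˡ (·-⊛ a (shift f) g n))
    (solve 4 (λ a b c d → (a :* b) :* c :+ a :* d := a :* (b :* c :+ d)) refl
      a (f 0) (g (suc n)) ((shift f ⊛ g) n))

  ⊛-· : ∀ a f g → f ⊛ (a · g) ≋ a · (f ⊛ g)
  ⊛-· a f g zero    = solve 3 (λ a b c → b :* (a :* c) := a :* (b :* c)) refl a (f 0) (g 0)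
  ⊛-· a f g (suc n) = trans (+-congˡ (⊛-· a (shift f) g n))
    (solve 4 (λ a b c d → b :* (a :* c) :+ a :* d := a :* (b :* c :+ d)) refl
      a (f 0) (g (suc n)) ((shift f ⊛ g) n))

  -- The product recurses on its left factor; this is the mirror image, which the Leibniz rule for
  -- `D` needs in its second term.
  shift-⊛ʳ : ∀ f g n → (f ⊛ g) (suc n) ≈ f (suc n) * g 0 + (f ⊛ shift g) n
  shift-⊛ʳ f g zero    = +-comm _ _
  shift-⊛ʳ f g (suc n) = trans (+-congˡ (shift-⊛ʳ (shift f) g n))
    (solve 3 (λ a b c → a :+ (b :+ c) := b :+ (a :+ c)) refl _ _ _)

  rescale-⊛ : ∀ a f g → rescale a f ⊛ rescale a g ≋ rescale a (f ⊛ g)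
  rescale-⊛ a f g zero    = solve 2 (λ x y → (con 1 :* x) :* (con 1 :* y) := con 1 :* (x :* y)) refl _ _
  rescale-⊛ a f g (suc n) = begin
    1# * f 0 * (a * a ^ n * g (suc n)) + (shift (rescale a f) ⊛ rescale a g) n
      ≈⟨ +-congˡ (⊛-cong {g = rescale a g} (λ k → *-assoc _ _ _) (λ _ → refl) n) ⟩
    1# * f 0 * (a * a ^ n * g (suc n)) + ((a · rescale a (shift f)) ⊛ rescale a g) n
      ≈⟨ +-congˡ (trans (·-⊛ a _ _ n) (*-congˡ (rescale-⊛ a (shift f) g n))) ⟩
    1# * f 0 * (a * a ^ n * g (suc n)) + a * (a ^ n * (shift f ⊛ g) n)
      ≈⟨ solve 5 (λ x a b y z → con 1 :* x :* (a :* b :* y) :+ a :* (b :* z) := a :* b :* (x :* y :+ z))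
           refl _ _ _ _ _ ⟩
    a * a ^ n * (f 0 * g (suc n) + (shift f ⊛ g) n) ∎

  -- Derivations of the ring of power series

  record IsDerivation (Δ : Series → Series) : Set (c ⊔ ℓ) where
    field
      cong    : ∀ {f g} → f ≋ g → Δ f ≋ Δ g
      ⊕-homo  : ∀ f g → Δ (f ⊕ g) ≋ Δ f ⊕ Δ g
      ·-homo  : ∀ a f → Δ (a · f) ≋ a · Δ f
      leibniz : ∀ f g → Δ (f ⊛ g) ≋ Δ f ⊛ g ⊕ f ⊛ Δ g

  -- The Euler operator `x d/dx`. It preserves degree, so its Leibniz rule fits the recursion of
  -- `⊛`; that of `D` is then read off by a shift.
  θ : Series → Series
  θ f n = n × f n

  D : Series → Series
  D f = shift (θ f)

  -- (1 + x) d/dx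
  M : Series → Series
  M f = D f ⊕ θ f

  θ-isDerivation : IsDerivation θ
  θ-isDerivation = record
    { cong    = λ p n → ×-congʳ n (p n)
    ; ⊕-homo  = λ f g n → ×-distrib-+ n (f n) (g n)
    ; ·-homo  = λ a f n → sym (×-comm-* n a (f n))
    ; leibniz = leibniz }
    where
    ×-distrib-+ : ∀ n x y → n × (x + y) ≈ n × x + n × y
    ×-distrib-+ zero    x y = sym (+-identityˡ _)
    ×-distrib-+ (suc n) x y = trans (+-congˡ (×-distrib-+ n x y))
      (solve 4 (λ a b c d → (a :+ b) :+ (c :+ d) := (a :+ c) :+ (b :+ d)) refl _ _ _ _)
    leibniz : ∀ f g → θ (f ⊛ g) ≋ θ f ⊛ g ⊕ f ⊛ θ g
    leibniz f g zero    = sym (trans (+-cong (zeroˡ _) (zeroʳ _)) (+-identityˡ _))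
    leibniz f g (suc n) = begin
      suc n × (f 0 * g (suc n) + (shift f ⊛ g) n)
        ≈⟨ ×-distrib-+ (suc n) _ _ ⟩
      suc n × (f 0 * g (suc n)) + ((shift f ⊛ g) n + θ (shift f ⊛ g) n)
        ≈⟨ +-cong (sym (×-comm-* (suc n) _ _)) (+-congˡ (leibniz (shift f) g n)) ⟩
      f 0 * θ g (suc n) + ((shift f ⊛ g) n + ((θ (shift f) ⊛ g) n + (shift f ⊛ θ g) n))
        ≈⟨ solve 5 (λ a b c d z → a :+ (b :+ (c :+ d)) := (con 0 :* z :+ (b :+ c)) :+ (a :+ d)) refl
             _ _ _ _ (g (suc n)) ⟩
      (0# * g (suc n) + ((shift f ⊛ g) n + (θ (shift f) ⊛ g) n)) + (f 0 * θ g (suc n) + (shift f ⊛ θ g) n)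
        ≈⟨ +-congʳ (+-congˡ (⊛-distribʳ-⊕ g (shift f) (θ (shift f)) n)) ⟨
      (θ f ⊛ g) (suc n) + (f ⊛ θ g) (suc n) ∎

  -- The Leibniz rule for `θ` in degree `suc n`: the constant terms of `θ f` and `θ g` vanish, so
  -- the shift passes onto the differentiated factor.
  D-isDerivation : IsDerivation D
  D-isDerivation = record
    { cong    = λ p n → cong p (suc n)
    ; ⊕-homo  = λ f g n → ⊕-homo f g (suc n)
    ; ·-homo  = λ a f n → ·-homo a f (suc n)
    ; leibniz = λ f g n → trans (leibniz f g (suc n))
        (+-cong (trans (+-congʳ (zeroˡ _)) (+-identityˡ _))
                (trans (shift-⊛ʳ f (θ g) n) (trans (+-congʳ (zeroʳ _)) (+-identityˡ _)))) }
    where open IsDerivation θ-isDerivation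

  ⊕-isDerivation : ∀ {Δ Δ′} → IsDerivation Δ → IsDerivation Δ′ → IsDerivation (λ f → Δ f ⊕ Δ′ f)
  ⊕-isDerivation {Δ} {Δ′} d d′ = record
    { cong    = λ p n → +-cong (d.cong p n) (d′.cong p n)
    ; ⊕-homo  = λ f g n → trans (+-cong (d.⊕-homo f g n) (d′.⊕-homo f g n)) (interchange _ _ _ _)
    ; ·-homo  = λ a f n → trans (+-cong (d.·-homo a f n) (d′.·-homo a f n)) (sym (distribˡ _ _ _))
    ; leibniz = λ f g n → begin
        Δ (f ⊛ g) n + Δ′ (f ⊛ g) n
          ≈⟨ +-cong (d.leibniz f g n) (d′.leibniz f g n) ⟩
        ((Δ f ⊛ g) n + (f ⊛ Δ g) n) + ((Δ′ f ⊛ g) n + (f ⊛ Δ′ g) n)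
          ≈⟨ interchange _ _ _ _ ⟩
        ((Δ f ⊛ g) n + (Δ′ f ⊛ g) n) + ((f ⊛ Δ g) n + (f ⊛ Δ′ g) n)
          ≈⟨ +-cong (⊛-distribʳ-⊕ g (Δ f) (Δ′ f) n) (⊛-distribˡ-⊕ f (Δ g) (Δ′ g) n) ⟨
        ((Δ f ⊕ Δ′ f) ⊛ g ⊕ f ⊛ (Δ g ⊕ Δ′ g)) n ∎ }
    where
    module d = IsDerivation d
    module d′ = IsDerivation d′
    interchange : ∀ a b c d → (a + b) + (c + d) ≈ (a + c) + (b + d)
    interchange = solve 4 (λ a b c d → (a :+ b) :+ (c :+ d) := (a :+ c) :+ (b :+ d)) refl

  ·-isDerivation : ∀ a {Δ} → IsDerivation Δ → IsDerivation (λ f → a · Δ f)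
  ·-isDerivation a {Δ} d = record
    { cong    = λ p n → *-congˡ (cong p n)
    ; ⊕-homo  = λ f g n → trans (*-congˡ (⊕-homo f g n)) (distribˡ _ _ _)
    ; ·-homo  = λ b f n → trans (*-congˡ (·-homo b f n))
        (solve 3 (λ a b c → a :* (b :* c) := b :* (a :* c)) refl _ _ _)
    ; leibniz = λ f g n → begin
        a * Δ (f ⊛ g) n                              ≈⟨ *-congˡ (leibniz f g n) ⟩
        a * ((Δ f ⊛ g) n + (f ⊛ Δ g) n)              ≈⟨ distribˡ _ _ _ ⟩
        a * (Δ f ⊛ g) n + a * (f ⊛ Δ g) n            ≈⟨ +-cong (·-⊛ a (Δ f) g n) (⊛-· a f (Δ g) n) ⟨
        (((a · Δ f) ⊛ g) ⊕ (f ⊛ (a · Δ g))) n        ∎ }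
    where open IsDerivation d

  M-isDerivation : IsDerivation M
  M-isDerivation = ⊕-isDerivation D-isDerivation θ-isDerivation

  -- Moments along the flow of a derivation

  iterate-cong : ∀ {Δ : Series → Series} → (∀ {f g} → f ≋ g → Δ f ≋ Δ g) →
                 ∀ {f g} → f ≋ g → ∀ n → iterate Δ f n ≋ iterate Δ g n
  iterate-cong cong p zero    = p
  iterate-cong cong p (suc n) = iterate-cong cong (cong p) n

  -- The exponential moments of f: if Δ = φ ∂ is a vector field, then
  -- Σ moments Δ f n uⁿ/n! is the expansion of f along the flow of Δ from 0.
  moments : (Series → Series) → Series → Series
  moments Δ f n = iterate Δ f n 0

  id+_ : (Series → Series) → Series → Series
  (id+ Δ) f = Δ f ⊕ f

  -- binomial b n = Σₖ C(n,k) b k.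
  binomial : Series → Series
  binomial b = moments (id+ shift) b

  id+shift-cong : ∀ {f g} → f ≋ g → (id+ shift) f ≋ (id+ shift) g
  id+shift-cong p n = +-cong (p (suc n)) (p n)

  module _ {Δ : Series → Series} (Δ-isDerivation : IsDerivation Δ) where
    open IsDerivation Δ-isDerivation

    -- Since `Δ (f e) = (Δ f + f) e`, multiplication by `e` conjugates `Δ` into `Δ + id`.
    iterate-⊛ : ∀ {e} → Δ e ≋ e → ∀ f n → iterate Δ (f ⊛ e) n ≋ iterate (id+ Δ) f n ⊛ e
    iterate-⊛     Δe≋e f zero    _ = refl
    iterate-⊛ {e} Δe≋e f (suc n) k = trans (iterate-cong cong step n k) (iterate-⊛ Δe≋e _ n k)
      where
      step : Δ (f ⊛ e) ≋ (Δ f ⊕ f) ⊛ e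
      step m = begin
        Δ (f ⊛ e) m                 ≈⟨ leibniz f e m ⟩
        (Δ f ⊛ e) m + (f ⊛ Δ e) m   ≈⟨ +-congˡ (⊛-cong {f = f} (λ _ → refl) Δe≋e m) ⟩
        (Δ f ⊛ e) m + (f ⊛ e) m     ≈⟨ ⊛-distribʳ-⊕ e (Δ f) f m ⟨
        ((Δ f ⊕ f) ⊛ e) m           ∎

    moments-⊕ : ∀ f g → moments Δ (f ⊕ g) ≋ moments Δ f ⊕ moments Δ g
    moments-⊕ f g zero    = refl
    moments-⊕ f g (suc n) = trans (iterate-cong cong (⊕-homo f g) n 0) (moments-⊕ (Δ f) (Δ g) n)

    -- Taking moments turns `Δ` into `shift`, definitionally, and is additive, so `id+ Δ` becomes
    -- `id+ shift`.
    moments-id+ : ∀ f n → moments (id+ Δ) f n ≈ binomial (moments Δ f) n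
    moments-id+ f zero    = refl
    moments-id+ f (suc n) = trans (moments-id+ (Δ f ⊕ f) n) (iterate-cong id+shift-cong (moments-⊕ (Δ f) f) n 0)

    moments-⊛ : ∀ {e} → Δ e ≋ e → e 0 ≈ 1# → ∀ f n → moments Δ (f ⊛ e) n ≈ binomial (moments Δ f) n
    moments-⊛ {e} Δe≋e e₀≈1 f n = begin
      moments Δ (f ⊛ e) n           ≈⟨ iterate-⊛ Δe≋e f n 0 ⟩
      moments (id+ Δ) f n * e 0     ≈⟨ trans (*-congˡ e₀≈1) (*-identityʳ _) ⟩
      moments (id+ Δ) f n           ≈⟨ moments-id+ f n ⟩
      binomial (moments Δ f) n      ∎

    moments-· : ∀ a f → moments Δ (a · f) ≋ a · moments Δ f
    moments-· a f zero    = refl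
    moments-· a f (suc n) = trans (iterate-cong cong (·-homo a f) n 0) (moments-· a (Δ f) n)

    Δ-zero : ∀ {f} → (∀ n → f n ≈ 0#) → ∀ n → Δ f n ≈ 0#
    Δ-zero {f} f≋0 n = begin
      Δ f n          ≈⟨ cong (λ k → trans (f≋0 k) (sym (zeroˡ (f k)))) n ⟩
      Δ (0# · f) n   ≈⟨ ·-homo 0# f n ⟩
      0# * Δ f n     ≈⟨ zeroˡ _ ⟩
      0#             ∎

    moments-zero : ∀ {f} → (∀ n → f n ≈ 0#) → ∀ n → moments Δ f n ≈ 0#
    moments-zero f≋0 zero    = f≋0 0
    moments-zero f≋0 (suc n) = moments-zero (Δ-zero f≋0) n

    -- The resulting recurrence mentions `Δ` and `e` only through moments. This makes series living
    -- over different derivations comparable.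
    moments-functionalEquation : ∀ {e} → Δ e ≋ e → e 0 ≈ 1# → ∀ {q f r} → q · (f ⊛ e) ≋ r ⊕ f →
      q · binomial (moments Δ f) ≋ moments Δ r ⊕ moments Δ f
    moments-functionalEquation {e} Δe≋e e₀≈1 {q} {f} {r} eq n = begin
      q * binomial (moments Δ f) n    ≈⟨ *-congˡ (moments-⊛ Δe≋e e₀≈1 f n) ⟨
      q * moments Δ (f ⊛ e) n         ≈⟨ moments-· q (f ⊛ e) n ⟨
      moments Δ (q · (f ⊛ e)) n       ≈⟨ iterate-cong cong eq n 0 ⟩
      moments Δ (r ⊕ f) n             ≈⟨ moments-⊕ r f n ⟩
      moments Δ r n + moments Δ f n   ∎

    -- Here `l` is the time parameter of the flow: it vanishes at 0 and has derivative 1. The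
    -- right-hand side is free of `Δ` and `l`, which is why both families end up with the same `r`.
    moments-affine : ∀ {l} → (∀ n → Δ δ n ≈ 0#) → l 0 ≈ 0# → Δ l ≋ δ →
      ∀ a s → moments Δ (a · δ ⊕ s · l) ≋ a · δ ⊕ s · X
    moments-affine {l} Δδ≋0 l₀≈0 Δl≋δ a s zero    = +-congˡ (*-congˡ l₀≈0)
    moments-affine {l} Δδ≋0 l₀≈0 Δl≋δ a s (suc n) =
      trans (iterate-cong cong step n 0) (rest n)
      where
      step : Δ (a · δ ⊕ s · l) ≋ s · δ
      step k = begin
        Δ (a · δ ⊕ s · l) k           ≈⟨ ⊕-homo (a · δ) (s · l) k ⟩
        Δ (a · δ) k + Δ (s · l) k     ≈⟨ +-cong (·-homo a δ k) (·-homo s l k) ⟩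
        a * Δ δ k + s * Δ l k         ≈⟨ +-cong (trans (*-congˡ (Δδ≋0 k)) (zeroʳ a)) (*-congˡ (Δl≋δ k)) ⟩
        0# + s * δ k                  ≈⟨ +-identityˡ _ ⟩
        s * δ k                       ∎
      rest : ∀ n → moments Δ (s · δ) n ≈ a * 0# + s * δ n
      rest zero    = sym (trans (+-congʳ (zeroʳ a)) (+-identityˡ _))
      rest (suc n) = trans (moments-zero (λ k → trans (·-homo s δ k) (trans (*-congˡ (Δδ≋0 k)) (zeroʳ s))) n)
        (sym (trans (+-cong (zeroʳ a) (zeroʳ s)) (+-identityˡ _)))

    moments-eigen : ∀ {a f} → Δ f ≋ a · f → ∀ n → moments Δ f n ≈ a ^ n * f 0
    moments-eigen         Δf≋af zero    = sym (*-identityˡ _)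
    moments-eigen {a} {f} Δf≋af (suc n) = begin
      moments Δ (Δ f) n       ≈⟨ iterate-cong cong Δf≋af n 0 ⟩
      moments Δ (a · f) n     ≈⟨ moments-· a f n ⟩
      a * moments Δ f n       ≈⟨ *-congˡ (moments-eigen Δf≋af n) ⟩
      a * (a ^ n * f 0)       ≈⟨ *-assoc _ _ _ ⟨
      a * a ^ n * f 0         ∎

  moments-scale : ∀ {Δ} → IsDerivation Δ → ∀ a f n → moments (λ g → a · Δ g) f n ≈ a ^ n * moments Δ f n
  moments-scale     d a f zero    = sym (*-identityˡ _)
  moments-scale {Δ} d a f (suc n) = begin
    moments (λ g → a · Δ g) (a · Δ f) n   ≈⟨ moments-scale d a (a · Δ f) n ⟩
    a ^ n * moments Δ (a · Δ f) n         ≈⟨ *-congˡ (moments-· d a (Δ f) n) ⟩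
    a ^ n * (a * moments Δ (Δ f) n)       ≈⟨ solve 3 (λ x y z → x :* (y :* z) := y :* x :* z) refl _ _ _ ⟩
    a * a ^ n * moments Δ (Δ f) n         ∎

  ×-zeroʳ : ∀ n → n × 0# ≈ 0#
  ×-zeroʳ zero    = refl
  ×-zeroʳ (suc n) = trans (+-identityˡ _) (×-zeroʳ n)

  θδ≋0 : ∀ n → θ δ n ≈ 0#
  θδ≋0 zero    = refl
  θδ≋0 (suc n) = ×-zeroʳ (suc n)

  Dδ≋0 : ∀ n → D δ n ≈ 0#
  Dδ≋0 n = θδ≋0 (suc n)

  Mδ≋0 : ∀ n → M δ n ≈ 0#
  Mδ≋0 n = trans (+-cong (Dδ≋0 n) (θδ≋0 n)) (+-identityˡ _)

  DX≋δ : D X ≋ δ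
  DX≋δ zero    = +-identityʳ _
  DX≋δ (suc n) = ×-zeroʳ (2 ℕ.+ n)

  -- For e the exponential series, b n * e n are the coefficients of the
  -- exponential generating function of b.
  moments-egf : ∀ {e} → D e ≋ e → e 0 ≈ 1# → ∀ b → moments D (λ n → b n * e n) ≋ b
  moments-egf     De≋e e₀≈1 b zero    = trans (*-congˡ e₀≈1) (*-identityʳ _)
  moments-egf {e} De≋e e₀≈1 b (suc n) = trans
    (iterate-cong (IsDerivation.cong D-isDerivation)
      (λ k → trans (sym (×-comm-* (suc k) _ _)) (*-congˡ (De≋e k))) n 0)
    (moments-egf De≋e e₀≈1 (shift b) n)

  -- `binomial b n` is `b n` plus terms of lower index; the equation says so without subtraction.
  -- The induction varies `b`, since `shift b ⊕ b` and `shift b′ ⊕ b′` again agree, up to one index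
  -- less.
  binomial-agree : ∀ {b b′} n → (∀ {j} → j ℕ.< n → b j ≈ b′ j) →
                   binomial b n + b′ n ≈ binomial b′ n + b n
  binomial-agree          zero    agree = +-comm _ _
  binomial-agree {b} {b′} (suc n) agree = +-cancelʳ (b′ n) _ _ (begin
    binomial (shift b ⊕ b) n + b′ (suc n) + b′ n     ≈⟨ +-assoc _ _ _ ⟩
    binomial (shift b ⊕ b) n + (shift b′ ⊕ b′) n     ≈⟨ binomial-agree n (λ j<n → +-cong (agree (s≤s j<n)) (agree (ℕ.m<n⇒m<1+n j<n))) ⟩
    binomial (shift b′ ⊕ b′) n + (shift b ⊕ b) n     ≈⟨ +-assoc _ _ _ ⟨
    binomial (shift b′ ⊕ b′) n + b (suc n) + b n     ≈⟨ +-congˡ (agree ℕ.≤-refl) ⟩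
    binomial (shift b′ ⊕ b′) n + b (suc n) + b′ n    ∎)

  -- In the equation at `n` the net coefficient of `b n` is `q - 1`, here the cancellable `a`; the
  -- remaining terms have smaller index and agree by strong induction.
  binomial-unique : ∀ {q a} → q ≈ a + 1# → (∀ x y → a * x ≈ a * y → x ≈ y) →
    ∀ {r b b′} → q · binomial b ≋ r ⊕ b → q · binomial b′ ≋ r ⊕ b′ → b ≋ b′
  binomial-unique {q} {a} q≈a+1 cancel {r} {b} {b′} eq eq′ = <-rec _ step
    where
    step : ∀ n → (∀ {j} → j ℕ.< n → b j ≈ b′ j) → b n ≈ b′ n
    step n agree = sym (cancel _ _ (+-cancelʳ (r n + b n + b′ n) _ _ (begin
      a * b′ n + (r n + b n + b′ n)
        ≈⟨ solve 4 (λ a b c d → a :* d :+ (b :+ c :+ d) := (b :+ c) :+ (a :+ con 1) :* d) refl _ _ _ _ ⟩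
      (r n + b n) + (a + 1#) * b′ n          ≈⟨ +-cong (eq n) (*-congʳ q≈a+1) ⟨
      q * binomial b n + q * b′ n            ≈⟨ distribˡ _ _ _ ⟨
      q * (binomial b n + b′ n)              ≈⟨ *-congˡ (binomial-agree n agree) ⟩
      q * (binomial b′ n + b n)              ≈⟨ distribˡ _ _ _ ⟩
      q * binomial b′ n + q * b n            ≈⟨ +-cong (eq′ n) (*-congʳ q≈a+1) ⟩
      (r n + b′ n) + (a + 1#) * b n
        ≈⟨ solve 4 (λ a b c d → (b :+ d) :+ (a :+ con 1) :* c := a :* c :+ (b :+ c :+ d)) refl _ _ _ _ ⟩
      a * b n + (r n + b n + b′ n)           ∎)))

  -- Iterates of `(1 + x) d/dx` and Stirling numbers

  -- w n l = l! S₂(n,l).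
  w : ℕ → ℕ → Carrier
  w zero    l       = δ l
  w (suc n) zero    = 0#
  w (suc n) (suc l) = suc l × (w n l + w n (suc l))

  w-zero : ∀ {n l} → n ℕ.< l → w n l ≈ 0#
  w-zero {zero}  {suc l} _         = refl
  w-zero {suc n} {suc l} (s≤s n<l) = trans
    (×-congʳ (suc l) (trans (+-cong (w-zero n<l) (w-zero (ℕ.m<n⇒m<1+n n<l))) (+-identityˡ _))) (×-zeroʳ (suc l))

  ∑ : ∀ n → Series → Carrier
  ∑ n f = ∑[ i < n ] f (toℕ i)

  ∑-init-last : ∀ n f → ∑ (suc n) f ≈ ∑ n f + f n
  ∑-init-last zero    f = +-comm _ _
  ∑-init-last (suc n) f = trans (+-congˡ (∑-init-last n (shift f))) (sym (+-assoc _ _ _))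

  ∑-cong : ∀ n {f g} → f ≋ g → ∑ n f ≈ ∑ n g
  ∑-cong n f≋g = sum-cong-≋ {n} (f≋g ∘ toℕ)

  ∑-⊕ : ∀ n f g → ∑ n (f ⊕ g) ≈ ∑ n f + ∑ n g
  ∑-⊕ n f g = ∑-distrib-+ {n} (f ∘ toℕ) (g ∘ toℕ)

  ∑-· : ∀ n a f → ∑ n (a · f) ≈ a * ∑ n f
  ∑-· n a f = sym (*-distribˡ-sum {n} a (f ∘ toℕ))

  ∑-zero : ∀ n {f} → (∀ k → f k ≈ 0#) → ∑ n f ≈ 0#
  ∑-zero zero    f≋0 = refl
  ∑-zero (suc n) f≋0 = trans (+-cong (f≋0 0) (∑-zero n (f≋0 ∘ suc))) (+-identityˡ _)

  -- The recursion for `w` is the transpose of `M`: as `M f l = (l + 1) f (l + 1) + l f l`, the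
  -- coefficient of `f l` in `∑ w n · M f` is `l (w n (l - 1) + w n l)`.
  moments-M : ∀ n f → moments M f n ≈ ∑ (suc n) (λ l → w n l * f l)
  moments-M zero    f = sym (trans (+-identityʳ _) (*-identityˡ _))
  moments-M (suc n) f = begin
    moments M (M f) n                       ≈⟨ moments-M n (M f) ⟩
    ∑ (suc n) (λ l → w n l * M f l)         ≈⟨ ∑-cong (suc n) (λ l → distribˡ (w n l) (D f l) (θ f l)) ⟩
    ∑ (suc n) (g ⊕ h)                       ≈⟨ ∑-⊕ (suc n) g h ⟩
    -- The sum over `h` is padded with the term at `suc n`, where `w n` vanishes, and then loses its
    -- term at 0, where `θ f` vanishes; after this shift it lines up with `g`.
    ∑ (suc n) g + ∑ (suc n) h               ≈⟨ +-congˡ (+-identityʳ _) ⟨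
    ∑ (suc n) g + (∑ (suc n) h + 0#)        ≈⟨ +-congˡ (+-congˡ (trans (*-congʳ (w-zero {n} ℕ.≤-refl)) (zeroˡ _))) ⟨
    ∑ (suc n) g + (∑ (suc n) h + h (suc n)) ≈⟨ +-congˡ (∑-init-last (suc n) h) ⟨
    ∑ (suc n) g + (h 0 + ∑ (suc n) (shift h))
      ≈⟨ +-congˡ (trans (+-congʳ (zeroʳ _)) (+-identityˡ _)) ⟩
    ∑ (suc n) g + ∑ (suc n) (shift h)       ≈⟨ ∑-⊕ (suc n) g (shift h) ⟨
    ∑ (suc n) (g ⊕ shift h)                 ≈⟨ ∑-cong (suc n) collect ⟩
    ∑ (suc n) (λ l → w (suc n) (suc l) * f (suc l))
      ≈⟨ trans (+-congʳ (zeroˡ _)) (+-identityˡ _) ⟨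
    ∑ (2 ℕ.+ n) (λ l → w (suc n) l * f l)   ∎
    where
    g h : Series
    g l = w n l * (suc l × f (suc l))
    h l = w n l * (l × f l)
    collect : ∀ l → g l + h (suc l) ≈ w (suc n) (suc l) * f (suc l)
    collect l = begin
      g l + h (suc l)                                        ≈⟨ distribʳ _ _ _ ⟨
      (w n l + w n (suc l)) * (suc l × f (suc l))            ≈⟨ ×-comm-* (suc l) _ _ ⟩
      suc l × ((w n l + w n (suc l)) * f (suc l))            ≈⟨ ×-assoc-* (suc l) _ _ ⟨
      w (suc n) (suc l) * f (suc l)                          ∎

-- Transport of the operators from rational to p-adic coefficients

module SeriesHomomorphism {c ℓ c′ ℓ′} (R : CommutativeRing c ℓ) (S : CommutativeRing c′ ℓ′)
         {φ : CommutativeRing.Carrier R → CommutativeRing.Carrier S}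
         (φ-isRingHomomorphism : IsRingHomomorphism (CommutativeRing.rawRing R) (CommutativeRing.rawRing S) φ) where
  private
    module R where
      open CommutativeRing R public
      open PowerSeries R public
      open Mult semiring public using (_×_)
    module S where
      open CommutativeRing S public
      open PowerSeries S public
      open Mult semiring public using (_×_; ×-congʳ)
  open IsRingHomomorphism φ-isRingHomomorphism

  ^-homo : ∀ x n → φ (x R.^ n) S.≈ φ x S.^ n
  ^-homo x zero    = 1#-homo
  ^-homo x (suc n) = S.trans (*-homo x (x R.^ n)) (S.*-congˡ (^-homo x n))

  ×-homo : ∀ n x → φ (n R.× x) S.≈ n S.× φ x
  ×-homo zero    x = 0#-homo
  ×-homo (suc n) x = S.trans (+-homo x (n R.× x)) (S.+-congˡ (×-homo n x))

  D-homo : ∀ f n → φ (R.D f n) S.≈ S.D (φ ∘ f) n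
  D-homo f n = ×-homo (suc n) (f (suc n))

  M-homo : ∀ f n → φ (R.M f n) S.≈ S.M (φ ∘ f) n
  M-homo f n = S.trans (+-homo _ _) (S.+-cong (D-homo f n) (×-homo n (f n)))

  δ-homo : ∀ n → φ (R.δ n) S.≈ S.δ n
  δ-homo zero    = 1#-homo
  δ-homo (suc n) = 0#-homo

  w-homo : ∀ n l → φ (R.w n l) S.≈ S.w n l
  w-homo zero    l       = δ-homo l
  w-homo (suc n) zero    = 0#-homo
  w-homo (suc n) (suc l) = S.trans (×-homo (suc l) _)
    (S.×-congʳ (suc l) (S.trans (+-homo _ _) (S.+-cong (w-homo n l) (w-homo n (suc l)))))

module ℚSeries = PowerSeries ℚ.+-*-commutativeRing

-- Rational coefficients: binomial series, logarithm and Stirling numbers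

module RationalSeries where
  open ≡ using (refl; sym; trans; cong; cong₂; module ≡-Reasoning)
  open CommutativeRing ℚ.+-*-commutativeRing using (semiring; commutativeSemiring)
  open Exp semiring using (^-assocʳ)
  open Mult semiring using (_×_)
  open CommutativeExp commutativeSemiring using (^-distrib-*)
  open ℚSolver.+-*-Solver using (solve; _:+_; _:*_; :-_; _:=_; con)

  toℚᵘ-/ : ∀ i n .{{_ : ℕ.NonZero n}} → toℚᵘ (i ℚ./ n) ℚᵘ.≃ i ℚᵘ./ n
  toℚᵘ-/ i (suc n) = ℚ.toℚᵘ-fromℚᵘ (mkℚᵘ i n)

  fromℤ-+ : ∀ i j → fromℤ (i ℤ.+ j) ≡ fromℤ i ℚ.+ fromℤ j
  fromℤ-+ i j = ℚ.toℚᵘ-injective (begin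
    toℚᵘ (fromℤ (i ℤ.+ j))                ≈⟨ toℚᵘ-/ (i ℤ.+ j) 1 ⟩
    mkℚᵘ (i ℤ.+ j) 0                      ≈⟨ *≡* (cong (ℤ._* + 1) (sym (cong₂ ℤ._+_ (ℤ.*-identityʳ i) (ℤ.*-identityʳ j)))) ⟩
    mkℚᵘ i 0 ℚᵘ.+ mkℚᵘ j 0                ≈⟨ ℚᵘ.+-cong (toℚᵘ-/ i 1) (toℚᵘ-/ j 1) ⟨
    toℚᵘ (fromℤ i) ℚᵘ.+ toℚᵘ (fromℤ j)    ≈⟨ ℚ.toℚᵘ-homo-+ (fromℤ i) (fromℤ j) ⟨
    toℚᵘ (fromℤ i ℚ.+ fromℤ j)            ∎)
    where open ℚᵘ.≃-Reasoning

  /-*-cancel : ∀ i n .{{_ : ℕ.NonZero n}} → fromℤ (+ n) ℚ.* (i ℚ./ n) ≡ fromℤ i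
  /-*-cancel i (suc n) = ℚ.toℚᵘ-injective (begin
    toℚᵘ (fromℤ (+ suc n) ℚ.* (i ℚ./ suc n))             ≈⟨ ℚ.toℚᵘ-homo-* (fromℤ (+ suc n)) (i ℚ./ suc n) ⟩
    toℚᵘ (fromℤ (+ suc n)) ℚᵘ.* toℚᵘ (i ℚ./ suc n)       ≈⟨ ℚᵘ.*-cong (toℚᵘ-/ (+ suc n) 1) (toℚᵘ-/ i (suc n)) ⟩
    mkℚᵘ (+ suc n) 0 ℚᵘ.* mkℚᵘ i n                       ≈⟨ *≡* (trans (ℤ.*-identityʳ _) (trans (ℤ.*-comm (+ suc n) i) (cong (λ k → i ℤ.* + k) (sym (ℕ.*-identityˡ (suc n)))))) ⟩
    mkℚᵘ i 0                                             ≈⟨ toℚᵘ-/ i 1 ⟨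
    toℚᵘ (fromℤ i)                                       ∎)
    where open ℚᵘ.≃-Reasoning

  fromℤ-*ℕ : ∀ i n → fromℤ (+ n ℤ.* i) ≡ fromℤ (+ n) ℚ.* fromℤ i
  fromℤ-*ℕ i n = ℚ.toℚᵘ-injective (begin
    toℚᵘ (fromℤ (+ n ℤ.* i))                  ≈⟨ toℚᵘ-/ (+ n ℤ.* i) 1 ⟩
    mkℚᵘ (+ n) 0 ℚᵘ.* mkℚᵘ i 0                ≈⟨ ℚᵘ.*-cong (toℚᵘ-/ (+ n) 1) (toℚᵘ-/ i 1) ⟨
    toℚᵘ (fromℤ (+ n)) ℚᵘ.* toℚᵘ (fromℤ i)    ≈⟨ ℚ.toℚᵘ-homo-* (fromℤ (+ n)) (fromℤ i) ⟨
    toℚᵘ (fromℤ (+ n) ℚ.* fromℤ i)            ∎)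
    where open ℚᵘ.≃-Reasoning

  fromℤ-suc : ∀ n → fromℤ (+ suc n) ≡ 1ℚ ℚ.+ fromℤ (+ n)
  fromℤ-suc n = fromℤ-+ (+ 1) (+ n)

  fromℤ-suc≢0 : ∀ n → fromℤ (+ suc n) ≢ 0ℚ
  fromℤ-suc≢0 n eq with ℚᵘ.≃-trans (ℚᵘ.≃-sym (toℚᵘ-/ (+ suc n) 1)) (ℚᵘ.≃-reflexive (cong toℚᵘ eq))
  ... | *≡* ()

  *-cancelˡ : ∀ x {y z} → x ≢ 0ℚ → x ℚ.* y ≡ x ℚ.* z → y ≡ z
  *-cancelˡ x {y} {z} x≢0 eq = begin
    y                      ≡⟨ ℚ.*-identityˡ y ⟨
    1ℚ ℚ.* y               ≡⟨ cong (ℚ._* y) (ℚ.*-inverseˡ x) ⟨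
    ℚ.1/ x ℚ.* x ℚ.* y     ≡⟨ ℚ.*-assoc (ℚ.1/ x) x y ⟩
    ℚ.1/ x ℚ.* (x ℚ.* y)   ≡⟨ cong (ℚ.1/ x ℚ.*_) eq ⟩
    ℚ.1/ x ℚ.* (x ℚ.* z)   ≡⟨ ℚ.*-assoc (ℚ.1/ x) x z ⟨
    ℚ.1/ x ℚ.* x ℚ.* z     ≡⟨ cong (ℚ._* z) (ℚ.*-inverseˡ x) ⟩
    1ℚ ℚ.* z               ≡⟨ ℚ.*-identityˡ z ⟩
    z                      ∎
    where
    open ≡-Reasoning
    instance _ = ℚ.≢-nonZero x≢0

  ×-fromℤ : ∀ n x → n × x ≡ fromℤ (+ n) ℚ.* x
  ×-fromℤ zero    x = sym (ℚ.*-zeroˡ x)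
  ×-fromℤ (suc n) x = begin
    x ℚ.+ n × x                        ≡⟨ cong₂ ℚ._+_ (sym (ℚ.*-identityˡ x)) (×-fromℤ n x) ⟩
    1ℚ ℚ.* x ℚ.+ fromℤ (+ n) ℚ.* x     ≡⟨ ℚ.*-distribʳ-+ x 1ℚ (fromℤ (+ n)) ⟨
    (1ℚ ℚ.+ fromℤ (+ n)) ℚ.* x         ≡⟨ cong (ℚ._* x) (fromℤ-suc n) ⟨
    fromℤ (+ suc n) ℚ.* x              ∎
    where open ≡-Reasoning

  n!*1/n! : ∀ n → fromℤ (+ (n !)) ℚ.* 1/ n ! ≡ 1ℚ
  n!*1/n! n = /-*-cancel (+ 1) (n !) {{ℕ._!≢0 n}}

  n!≢0 : ∀ n → fromℤ (+ (n !)) ≢ 0ℚ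
  n!≢0 n eq with n ! | ℕ._!≢0 n
  ... | suc k | _ = fromℤ-suc≢0 k eq

  1/n!-suc : ∀ n → fromℤ (+ suc n) ℚ.* 1/ suc n ! ≡ 1/ n !
  1/n!-suc n = *-cancelˡ (fromℤ (+ (n !))) (n!≢0 n) (begin
    fromℤ (+ (n !)) ℚ.* (fromℤ (+ suc n) ℚ.* 1/ suc n !)
      ≡⟨ solve 3 (λ a b c → a :* (b :* c) := b :* a :* c) refl (fromℤ (+ (n !))) (fromℤ (+ suc n)) (1/ suc n !) ⟩
    fromℤ (+ suc n) ℚ.* fromℤ (+ (n !)) ℚ.* 1/ suc n !
      ≡⟨ cong (ℚ._* 1/ suc n !) (fromℤ-*ℕ (+ (n !)) (suc n)) ⟨
    fromℤ (+ suc n ℤ.* + (n !)) ℚ.* 1/ suc n !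
      ≡⟨ cong (λ i → fromℤ i ℚ.* 1/ suc n !) (ℤ.pos-* (suc n) (n !)) ⟨
    fromℤ (+ (suc n !)) ℚ.* 1/ suc n !
      ≡⟨ trans (n!*1/n! (suc n)) (sym (n!*1/n! n)) ⟩
    fromℤ (+ (n !)) ℚ.* 1/ n ! ∎)
    where open ≡-Reasoning

  open ℚSeries using (Series; _≋_; D; M; δ; w; moments; moments-M;
    moments-eigen; M-isDerivation; ∑; ∑-cong; ∑-⊕; ∑-·; ∑-zero; _^_)

  D-1/! : D 1/_! ≋ 1/_!
  D-1/! n = trans (×-fromℤ (suc n) (1/ suc n !)) (1/n!-suc n)

  binom : ℚ → Series
  binom x l = fallingFactorial x l ℚ.* 1/ l !

  -- (1 + u)ˣ is an eigenvector of (1 + u) d/du.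
  M-binom : ∀ x l → M (binom x) l ≡ x ℚ.* binom x l
  M-binom x l = begin
    suc l × binom x (suc l) ℚ.+ l × binom x l
      ≡⟨ cong₂ ℚ._+_ (×-fromℤ (suc l) (binom x (suc l))) (×-fromℤ l (binom x l)) ⟩
    fromℤ (+ suc l) ℚ.* (fallingFactorial x l ℚ.* (x ℚ.- fromℤ (+ l)) ℚ.* 1/ suc l !) ℚ.+ fromℤ (+ l) ℚ.* binom x l
      ≡⟨ cong (ℚ._+ fromℤ (+ l) ℚ.* binom x l)
           (solve 4 (λ a b c d → a :* (b :* c :* d) := b :* c :* (a :* d)) refl
             (fromℤ (+ suc l)) (fallingFactorial x l) (x ℚ.- fromℤ (+ l)) (1/ suc l !)) ⟩
    fallingFactorial x l ℚ.* (x ℚ.- fromℤ (+ l)) ℚ.* (fromℤ (+ suc l) ℚ.* 1/ suc l !) ℚ.+ fromℤ (+ l) ℚ.* binom x l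
      ≡⟨ cong (λ r → fallingFactorial x l ℚ.* (x ℚ.- fromℤ (+ l)) ℚ.* r ℚ.+ fromℤ (+ l) ℚ.* binom x l) (1/n!-suc l) ⟩
    fallingFactorial x l ℚ.* (x ℚ.- fromℤ (+ l)) ℚ.* 1/ l ! ℚ.+ fromℤ (+ l) ℚ.* (fallingFactorial x l ℚ.* 1/ l !)
      ≡⟨ solve 4 (λ f x l i → f :* (x :+ :- l) :* i :+ l :* (f :* i) := x :* (f :* i)) refl
           (fallingFactorial x l) x (fromℤ (+ l)) (1/ l !) ⟩
    x ℚ.* binom x l ∎
    where open ≡-Reasoning

  fromℤ-neg : ∀ i → fromℤ (ℤ.- i) ≡ ℚ.- fromℤ i
  fromℤ-neg i = begin
    fromℤ (ℤ.- i)  ≡⟨ solve 2 (λ a b → b := (a :+ b) :+ :- a) refl (fromℤ i) (fromℤ (ℤ.- i)) ⟩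
    fromℤ i ℚ.+ fromℤ (ℤ.- i) ℚ.- fromℤ i  ≡⟨ cong (ℚ._- fromℤ i) (trans (sym (fromℤ-+ i (ℤ.- i))) (cong fromℤ (ℤ.+-inverseʳ i))) ⟩
    0ℚ ℚ.- fromℤ i  ≡⟨ ℚ.+-identityˡ _ ⟩
    ℚ.- fromℤ i ∎
    where open ≡-Reasoning

  -- `n` times the `n`-th coefficient is an alternating sign, so the two contributions to `M` cancel
  -- in positive degree.
  M-logCoeff : M logCoeff ≋ δ
  M-logCoeff zero    = refl
  M-logCoeff (suc n) = begin
    suc (suc n) × logCoeff (suc (suc n)) ℚ.+ suc n × logCoeff (suc n)
      ≡⟨ cong₂ ℚ._+_ (term (suc n)) (term n) ⟩
    fromℤ (-1ℤ ℤ.* (-1ℤ ℤ.^ n)) ℚ.+ fromℤ (-1ℤ ℤ.^ n)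
      ≡⟨ cong (ℚ._+ fromℤ (-1ℤ ℤ.^ n)) (trans (cong fromℤ (ℤ.-1*i≡-i (-1ℤ ℤ.^ n))) (fromℤ-neg (-1ℤ ℤ.^ n))) ⟩
    ℚ.- fromℤ (-1ℤ ℤ.^ n) ℚ.+ fromℤ (-1ℤ ℤ.^ n)
      ≡⟨ ℚ.+-inverseˡ (fromℤ (-1ℤ ℤ.^ n)) ⟩
    0ℚ ∎
    where
    open ≡-Reasoning
    term : ∀ n → suc n × logCoeff (suc n) ≡ fromℤ (-1ℤ ℤ.^ n)
    term n = trans (×-fromℤ (suc n) (logCoeff (suc n))) (/-*-cancel (-1ℤ ℤ.^ n) (suc n))

  -- The definition splits off the last factor; splitting off the first is what permits division by
  -- `m + 1` in `fallingFactorial-unique`.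
  fallingFactorial-suc : ∀ x l → fallingFactorial (1ℚ ℚ.+ x) (suc l) ≡ (1ℚ ℚ.+ x) ℚ.* fallingFactorial x l
  fallingFactorial-suc x zero    = solve 1 (λ x → con 1ℚ :* (con 1ℚ :+ x :+ :- con 0ℚ) := (con 1ℚ :+ x) :* con 1ℚ) refl x
  fallingFactorial-suc x (suc l) = begin
    fallingFactorial (1ℚ ℚ.+ x) (suc l) ℚ.* (1ℚ ℚ.+ x ℚ.- fromℤ (+ suc l))
      ≡⟨ cong₂ (λ a b → a ℚ.* (1ℚ ℚ.+ x ℚ.- b)) (fallingFactorial-suc x l) (fromℤ-suc l) ⟩
    (1ℚ ℚ.+ x) ℚ.* fallingFactorial x l ℚ.* (1ℚ ℚ.+ x ℚ.- (1ℚ ℚ.+ fromℤ (+ l)))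
      ≡⟨ solve 3 (λ f x l → (con 1ℚ :+ x) :* f :* (con 1ℚ :+ x :+ :- (con 1ℚ :+ l)) := (con 1ℚ :+ x) :* (f :* (x :+ :- l)))
           refl (fallingFactorial x l) x (fromℤ (+ l)) ⟩
    (1ℚ ℚ.+ x) ℚ.* fallingFactorial x (suc l) ∎
    where open ≡-Reasoning

  fallingFactorial-0 : ∀ l → fallingFactorial 0ℚ (suc l) ≡ 0ℚ
  fallingFactorial-0 zero    = refl
  fallingFactorial-0 (suc l) = trans (cong (ℚ._* (0ℚ ℚ.- fromℤ (+ suc l))) (fallingFactorial-0 l)) (ℚ.*-zeroˡ (0ℚ ℚ.- fromℤ (+ suc l)))

  -- Evaluation at 0 leaves only `a 0`. At `m + 1`, every remaining falling factorial is `m + 1`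
  -- times one of `m` of length one less; dividing gives the same hypothesis for the shifted
  -- coefficients.
  fallingFactorial-unique : ∀ N (a : Series) →
    (∀ m → ∑ N (λ l → a l ℚ.* fallingFactorial (fromℤ (+ m)) l) ≡ 0ℚ) →
    ∀ l → l ℕ.< N → a l ≡ 0ℚ
  fallingFactorial-unique (suc N) a vanish = λ
    { zero    _         → a₀≡0
    ; (suc l) (s≤s l<N) → fallingFactorial-unique N (a ∘ suc) vanish′ l l<N
    }
    where
    open ≡-Reasoning
    a₀≡0 : a 0 ≡ 0ℚ
    a₀≡0 = begin
      a 0                     ≡⟨ solve 1 (λ x → x := x :* con 1ℚ :+ con 0ℚ) refl (a 0) ⟩
      a 0 ℚ.* 1ℚ ℚ.+ 0ℚ       ≡⟨ cong (a 0 ℚ.* 1ℚ ℚ.+_) (∑-zero N λ l →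
                                   trans (cong (a (suc l) ℚ.*_) (fallingFactorial-0 l)) (ℚ.*-zeroʳ (a (suc l)))) ⟨
      a 0 ℚ.* 1ℚ ℚ.+ ∑ N (λ l → a (suc l) ℚ.* fallingFactorial 0ℚ (suc l))
                              ≡⟨ vanish 0 ⟩
      0ℚ                      ∎
    vanish′ : ∀ m → ∑ N (λ l → a (suc l) ℚ.* fallingFactorial (fromℤ (+ m)) l) ≡ 0ℚ
    vanish′ m = *-cancelˡ x (fromℤ-suc≢0 m) (begin
      x ℚ.* ∑ N (λ l → a (suc l) ℚ.* f l)    ≡⟨ ∑-· N x (λ l → a (suc l) ℚ.* f l) ⟨
      ∑ N (λ l → x ℚ.* (a (suc l) ℚ.* f l))  ≡⟨ ∑-cong N step ⟩
      ∑ N (λ l → a (suc l) ℚ.* g l)          ≡⟨ solve 2 (λ b s → s := con 0ℚ :* b :+ s) refl 1ℚ (∑ N (λ l → a (suc l) ℚ.* g l)) ⟩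
      0ℚ ℚ.* 1ℚ ℚ.+ ∑ N (λ l → a (suc l) ℚ.* g l)
                                             ≡⟨ cong (λ b → b ℚ.* 1ℚ ℚ.+ ∑ N (λ l → a (suc l) ℚ.* g l)) a₀≡0 ⟨
      a 0 ℚ.* 1ℚ ℚ.+ ∑ N (λ l → a (suc l) ℚ.* g l)
                                             ≡⟨ vanish (suc m) ⟩
      0ℚ                                     ≡⟨ ℚ.*-zeroʳ x ⟨
      x ℚ.* 0ℚ                               ∎)
      where
      x : ℚ
      x = fromℤ (+ suc m)
      f g : Series
      f = fallingFactorial (fromℤ (+ m))
      g l = fallingFactorial x (suc l)
      step : ∀ l → x ℚ.* (a (suc l) ℚ.* f l) ≡ a (suc l) ℚ.* g l
      step l = begin
        x ℚ.* (a (suc l) ℚ.* f l)   ≡⟨ solve 3 (λ x a f → x :* (a :* f) := a :* (x :* f)) refl x (a (suc l)) (f l) ⟩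
        a (suc l) ℚ.* (x ℚ.* f l)   ≡⟨ cong (λ y → a (suc l) ℚ.* (y ℚ.* f l)) (fromℤ-suc m) ⟩
        a (suc l) ℚ.* ((1ℚ ℚ.+ fromℤ (+ m)) ℚ.* f l)
                                    ≡⟨ cong (a (suc l) ℚ.*_) (fallingFactorial-suc (fromℤ (+ m)) l) ⟨
        a (suc l) ℚ.* fallingFactorial (1ℚ ℚ.+ fromℤ (+ m)) (suc l)
                                    ≡⟨ cong (λ y → a (suc l) ℚ.* fallingFactorial y (suc l)) (fromℤ-suc m) ⟨
        a (suc l) ℚ.* g l           ∎

  -- The `n`-th moment of `(1 + u)ˣ` under `M`, computed once from the eigenvalue and once from the
  -- coefficients.
  ^≡∑w : ∀ n x → x ^ n ≡ ∑ (suc n) (λ l → w n l ℚ.* binom x l)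
  ^≡∑w n x = begin
    x ^ n                                       ≡⟨ ℚ.*-identityʳ (x ^ n) ⟨
    x ^ n ℚ.* 1ℚ                                ≡⟨ moments-eigen M-isDerivation (M-binom x) n ⟨
    moments M (binom x) n                       ≡⟨ moments-M n (binom x) ⟩
    ∑ (suc n) (λ l → w n l ℚ.* binom x l)       ∎
    where open ≡-Reasoning

  -- `S n l` and `w n l / l!` are both coefficients of `xⁿ` in the basis of falling factorials, and
  -- `a` is their difference. `IsStirling₂` constrains `S n l` only for `l ≤ n`.
  stirling₂-w : ∀ {S} → IsStirling₂ S → ∀ n {l} → l ℕ.≤ n → fromℤ (+ (l !)) ℚ.* fromℤ (S n l) ≡ w n l
  stirling₂-w {S} isStirling n {l} l≤n = begin
    fromℤ (+ (l !)) ℚ.* fromℤ (S n l)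
      ≡⟨ solve 4 (λ u s v i → u :* s := u :* (s :+ :- (v :* i)) :+ (u :* i) :* v) refl
           (fromℤ (+ (l !))) (fromℤ (S n l)) (w n l) (1/ l !) ⟩
    fromℤ (+ (l !)) ℚ.* a l ℚ.+ (fromℤ (+ (l !)) ℚ.* 1/ l !) ℚ.* w n l
      ≡⟨ cong₂ (λ y z → fromℤ (+ (l !)) ℚ.* y ℚ.+ z ℚ.* w n l)
           (fallingFactorial-unique (suc n) a vanish l (s≤s l≤n)) (n!*1/n! l) ⟩
    fromℤ (+ (l !)) ℚ.* 0ℚ ℚ.+ 1ℚ ℚ.* w n l
      ≡⟨ solve 2 (λ u v → u :* con 0ℚ :+ con 1ℚ :* v := v) refl (fromℤ (+ (l !))) (w n l) ⟩
    w n l ∎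
    where
    open ≡-Reasoning
    a : Series
    a l = fromℤ (S n l) ℚ.- w n l ℚ.* 1/ l !
    vanish : ∀ m → ∑ (suc n) (λ l → a l ℚ.* fallingFactorial (fromℤ (+ m)) l) ≡ 0ℚ
    vanish m = begin
      A                        ≡⟨ solve 2 (λ u v → u := (u :+ v) :+ :- v) refl A W ⟩
      A ℚ.+ W ℚ.- W            ≡⟨ cong (ℚ._- W) (∑-⊕ (suc n) (λ l → a l ℚ.* f l) (λ l → w n l ℚ.* binom x l)) ⟨
      ∑ (suc n) (λ l → a l ℚ.* f l ℚ.+ w n l ℚ.* binom x l) ℚ.- W
                               ≡⟨ cong (ℚ._- W) (∑-cong (suc n) λ l →
                                    solve 4 (λ s v i f → (s :+ :- (v :* i)) :* f :+ v :* (f :* i) := s :* f) refl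
                                      (fromℤ (S n l)) (w n l) (1/ l !) (f l)) ⟩
      ∑ (suc n) (λ l → fromℤ (S n l) ℚ.* f l) ℚ.- W
                               ≡⟨ cong (ℚ._- W) (isStirling n x) ⟨
      x ^ n ℚ.- W              ≡⟨ cong (ℚ._- W) (^≡∑w n x) ⟩
      W ℚ.- W                  ≡⟨ ℚ.+-inverseʳ W ⟩
      0ℚ                       ∎
      where
      x A W : ℚ
      f : Series
      x = fromℤ (+ m)
      f = fallingFactorial x
      A = ∑ (suc n) (λ l → a l ℚ.* f l)
      W = ∑ (suc n) (λ l → w n l ℚ.* binom x l)

  2^-⊖ : ∀ m n → 2^ (m ⊖ n) ≡ fromℤ (+ 2) ^ m ℚ.* ½ ^ n
  2^-⊖ zero    zero    = refl
  2^-⊖ zero    (suc n) = sym (ℚ.*-identityˡ _)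
  2^-⊖ (suc m) zero    = sym (ℚ.*-identityʳ _)
  2^-⊖ (suc m) (suc n) = begin
    2^ (suc m ⊖ suc n)                       ≡⟨ cong 2^_ (ℤ.[1+m]⊖[1+n]≡m⊖n m n) ⟩
    2^ (m ⊖ n)                               ≡⟨ 2^-⊖ m n ⟩
    fromℤ (+ 2) ^ m ℚ.* ½ ^ n                ≡⟨ solve 2 (λ a b → a :* b := con (fromℤ (+ 2)) :* a :* (con ½ :* b)) refl (fromℤ (+ 2) ^ m) (½ ^ n) ⟩
    fromℤ (+ 2) ^ suc m ℚ.* ½ ^ suc n        ∎
    where open ≡-Reasoning

  -- The factor in `t = -x/4`, written as a product so that its powers split into the sign and the
  -- power of ½ of the theorem.
  -¼ : ℚ
  -¼ = ℚ.- 1ℚ ℚ.* ½ ^ 2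

  stirling₂-coefficient : ∀ {S} → IsStirling₂ S → ∀ n {k} → k ℕ.≤ n →
    (ℚ.- 1ℚ) ^ k ℚ.* 2^ (n ⊖ 2 ℕ.* k) ℚ.* fromℤ (+ (k !)) ℚ.* fromℤ (S n k) ≡ fromℤ (+ 2) ^ n ℚ.* w n k ℚ.* -¼ ^ k
  stirling₂-coefficient {S} isStirling n {k} k≤n = begin
    e ℚ.* 2^ (n ⊖ 2 ℕ.* k) ℚ.* fromℤ (+ (k !)) ℚ.* fromℤ (S n k)
      ≡⟨ cong (λ y → e ℚ.* y ℚ.* fromℤ (+ (k !)) ℚ.* fromℤ (S n k)) (2^-⊖ n (2 ℕ.* k)) ⟩
    e ℚ.* (t ℚ.* ½ ^ (2 ℕ.* k)) ℚ.* fromℤ (+ (k !)) ℚ.* fromℤ (S n k)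
      ≡⟨ cong (λ y → e ℚ.* (t ℚ.* y) ℚ.* fromℤ (+ (k !)) ℚ.* fromℤ (S n k)) (^-assocʳ ½ 2 k) ⟨
    e ℚ.* (t ℚ.* (½ ^ 2) ^ k) ℚ.* fromℤ (+ (k !)) ℚ.* fromℤ (S n k)
      ≡⟨ solve 5 (λ e t h f s → e :* (t :* h) :* f :* s := t :* (f :* s) :* (e :* h)) refl
           e t ((½ ^ 2) ^ k) (fromℤ (+ (k !))) (fromℤ (S n k)) ⟩
    t ℚ.* (fromℤ (+ (k !)) ℚ.* fromℤ (S n k)) ℚ.* (e ℚ.* (½ ^ 2) ^ k)
      ≡⟨ cong₂ (λ y z → t ℚ.* y ℚ.* z) (stirling₂-w {S} isStirling n k≤n) (sym (^-distrib-* (ℚ.- 1ℚ) (½ ^ 2) k)) ⟩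
    t ℚ.* w n k ℚ.* -¼ ^ k ∎
    where
    open ≡-Reasoning
    e t : ℚ
    e = (ℚ.- 1ℚ) ^ k
    t = fromℤ (+ 2) ^ n

open RationalSeries

open AbelianGroupProperties (CommutativeRing.+-abelianGroup ℚ.+-*-commutativeRing) using ()
  renaming (//-rightDividesˡ to ℚ-rightDividesˡ)

p+1≰p : ∀ p → ¬ (p ℚ.+ 1ℚ ℚ.≤ p)
p+1≰p p p+1≤p = ℚ.<-irrefl ≡.refl (ℚ.<-≤-trans
  (ℚ.≤-<-trans (ℚ.≤-reflexive (≡.sym (ℚ.+-identityʳ p))) (ℚ.+-monoʳ-< p (ℚ.positive⁻¹ 1ℚ))) p+1≤p)

archimedean : ∀ r → ∃[ n ] r ℚ.≤ fromℤ (+ n)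
archimedean r@(ℚ.mkℚ i d _) = ℤ.∣ i ∣ , ℚ.toℚᵘ-cancel-≤ (ℚᵘ.≤-respʳ-≃ (ℚᵘ.≃-sym (toℚᵘ-/ (+ ℤ.∣ i ∣) 1)) (*≤* (begin
  i ℤ.* + 1                ≡⟨ ℤ.*-identityʳ i ⟩
  i                        ≤⟨ i≤∣i∣ i ⟩
  + ℤ.∣ i ∣                ≤⟨ ℤ.+≤+ (ℕ.m≤m*n ℤ.∣ i ∣ (suc d)) ⟩
  + (ℤ.∣ i ∣ ℕ.* suc d)    ≡⟨ ℤ.pos-* ℤ.∣ i ∣ (suc d) ⟩
  + ℤ.∣ i ∣ ℤ.* + suc d    ∎)))
  where
  open ℤ.≤-Reasoning
  i≤∣i∣ : ∀ i → i ℤ.≤ + ℤ.∣ i ∣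
  i≤∣i∣ (+ n)    = ℤ.≤-refl
  i≤∣i∣ -[1+ n ] = ℤ.-≤+

-- Valued fields: ultrametric estimates, convergence, expansions

module ValuedFieldProperties {c ℓ₁ ℓ₂} (K : ValuedField c ℓ₁ ℓ₂) where
  open Product using (_×_)
  open ValuedField K
  open HeytingProperties (ValuedField.heytingCommutativeRing K) using (1#0; x#0y#0→xy#0; x-0≈x; #-congʳ)
  open CommutativeRing commutativeRing using (ring; commutativeSemiring; +-abelianGroup)
  open RingProperties ring using (-‿distribʳ-*; -1*x≈-x; -‿involutive)
  open AbelianGroupProperties +-abelianGroup using (x∙y⁻¹≈ε⇒x≈y; ⁻¹-anti-homo-//; //-rightDividesˡ; //-rightDividesʳ) renaming (∙-cancelˡ to +-cancelˡ)
  open CommutativeExp commutativeSemiring using (^-distrib-*)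
  open Exp semiring using (^-congˡ; ^-homo-*; ^-assocʳ)
  open PowerSeries commutativeRing hiding (_^_)
  open Solver commutativeSemiring using (solve; _:+_; _:*_; _:=_; con)
  open SetoidReasoning setoid

  -- Apartness from 0 is decidable because the valuation can be inspected: a finite value gives
  -- apartness, and an infinite one refutes it, whence equality by tightness.
  #0⊎≈0 : ∀ x → x # 0# ⊎ x ≈ 0#
  #0⊎≈0 x with v x in eq
  ... | [ r ] = inj₁ (Equivalence.from (v-#0 x) (r , eq))
  ... | ⊤⁺    = inj₂ (proj₁ (tight x 0#) λ x#0 → case (Equivalence.to (v-#0 x) x#0))
    where
    case : ¬ (∃[ r ] v x ≡ [ r ])
    case (r , eq′) with ≡.trans (≡.sym eq) eq′
    ... | ()

  ¬0#0 : ¬ 0# # 0#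
  ¬0#0 = #-irrefl refl

  v-0 : v 0# ≡ ⊤⁺
  v-0 with v 0# in eq
  ... | [ r ] = contradiction (Equivalence.from (v-#0 0#) (r , eq)) ¬0#0
  ... | ⊤⁺    = ≡.refl

  infix 4 _≼_

  _≼_ : ℚ → Carrier → Set
  r ≼ x = [ r ] ≤⁺ v x

  ≼-resp-≈ : ∀ {r x y} → x ≈ y → r ≼ x → r ≼ y
  ≼-resp-≈ {r} x≈y = ≡.subst ([ r ] ≤⁺_) (v-cong x≈y)

  ≼-weaken : ∀ {r s x} → r ℚ.≤ s → s ≼ x → r ≼ x
  ≼-weaken r≤s s≼x = ≤⁺-trans ℚ.≤-trans [ r≤s ] s≼x

  ≼-0 : ∀ r → r ≼ 0#
  ≼-0 r = ≡.subst ([ r ] ≤⁺_) (≡.sym v-0) ([ r ] ≤⊤⁺)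

  ≼-+ : ∀ {r x y} → r ≼ x → r ≼ y → r ≼ x + y
  ≼-+ = v-+ _ _ _

  ≼-* : ∀ {r s x y} → r ≼ x → s ≼ y → r ℚ.+ s ≼ x * y
  ≼-* {r} {s} {x} {y} r≼x s≼y = ≡.subst ([ r ℚ.+ s ] ≤⁺_) (≡.sym (v-* x y)) (lemma r≼x s≼y)
    where
    lemma : ∀ {a b} → [ r ] ≤⁺ a → [ s ] ≤⁺ b → [ r ℚ.+ s ] ≤⁺ a +⁺ b
    lemma [ p ]     [ q ]     = [ ℚ.+-mono-≤ p q ]
    lemma [ p ]     (_ ≤⊤⁺)   = _ ≤⊤⁺
    lemma (_ ≤⊤⁺)   _         = _ ≤⊤⁺

  v-#0⁺ : ∀ {x} → x # 0# → ∃[ r ] v x ≡ [ r ]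
  v-#0⁺ = Equivalence.to (v-#0 _)

  0≼x²⇒0≼x : ∀ {x} → 0ℚ ≼ x * x → 0ℚ ≼ x
  0≼x²⇒0≼x {x} 0≼x² with v x in eq
  ... | ⊤⁺    = _ ≤⊤⁺
  ... | [ r ] with ℚ.≤-total 0ℚ r
  ...   | inj₁ 0≤r = [ 0≤r ]
  ...   | inj₂ r≤0 with ≡.subst ([ 0ℚ ] ≤⁺_) (≡.trans (v-* x x) (≡.cong₂ _+⁺_ eq eq)) 0≼x²
  ...     | [ 0≤r+r ] = [ ℚ.≤-trans 0≤r+r (ℚ.≤-trans (ℚ.+-monoʳ-≤ r r≤0) (ℚ.≤-reflexive (ℚ.+-identityʳ r))) ]

  0≼1 : 0ℚ ≼ 1#
  0≼1 with v-#0⁺ 1#0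
  ... | r , v1≡r = ≡.subst ([ 0ℚ ] ≤⁺_) (≡.sym v1≡r) [ ℚ.≤-reflexive (≡.sym r≡0) ]
    where
    [r]≡[r+r] : [ r ] ≡ [ r ℚ.+ r ]
    [r]≡[r+r] = ≡.trans (≡.sym v1≡r) (≡.trans (v-cong (sym (*-identityˡ 1#)))
                  (≡.trans (v-* 1# 1#) (≡.cong₂ _+⁺_ v1≡r v1≡r)))
    r≡0 : r ≡ 0ℚ
    r≡0 = ≡.trans (≡.sym (ℚ.+-identityʳ r)) (≡.trans (≡.cong (r ℚ.+_) (≡.sym (ℚ.+-inverseʳ r)))
            (≡.trans (≡.sym (ℚ.+-assoc r r (ℚ.- r))) (≡.trans (≡.cong (ℚ._- r) (≡.sym ([]-injective [r]≡[r+r]))) (ℚ.+-inverseʳ r))))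

  -- The valuation axioms do not mention negation; `(-1)² = 1` forces `v (- 1#)` to be nonnegative,
  -- and multiplicativity does the rest.
  ≼-neg : ∀ {r x} → r ≼ x → r ≼ - x
  ≼-neg {r} {x} r≼x = ≼-resp-≈ (-1*x≈-x x) (≼-weaken (ℚ.≤-reflexive (≡.sym (ℚ.+-identityˡ r))) (≼-* 0≼-1 r≼x))
    where
    0≼-1 : 0ℚ ≼ - 1#
    0≼-1 = 0≼x²⇒0≼x (≼-resp-≈ (sym (trans (-1*x≈-x (- 1#)) (-‿involutive 1#))) 0≼1)

  ≼-minus : ∀ {r x y} → r ≼ x → r ≼ y → r ≼ x - y
  ≼-minus r≼x r≼y = ≼-+ r≼x (≼-neg r≼y)

  ≼-∑ : ∀ {r} n {f} → (∀ k → r ≼ f k) → r ≼ ∑ n f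
  ≼-∑ zero    r≼f = ≼-0 _
  ≼-∑ (suc n) r≼f = ≼-+ (r≼f 0) (≼-∑ n (r≼f ∘ suc))

  ≼-separated : ∀ {x} → (∀ r → r ≼ x) → x ≈ 0#
  ≼-separated {x} all with #0⊎≈0 x
  ... | inj₂ x≈0 = x≈0
  ... | inj₁ x#0 with v-#0⁺ x#0
  ...   | s , eq with ≡.subst ([ s ℚ.+ 1ℚ ] ≤⁺_) eq (all (s ℚ.+ 1ℚ))
  ...     | [ s+1≤s ] = contradiction s+1≤s (p+1≰p s)

  ≼-inhabited : ∀ x → ∃[ r ] r ≼ x
  ≼-inhabited x with v x
  ... | [ r ] = r , [ ℚ.≤-refl ]
  ... | ⊤⁺    = 0ℚ , (_ ≤⊤⁺)

  minus-intro : ∀ {x y z} → x ≈ z + y → x - y ≈ z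
  minus-intro {_} {y} {z} x≈z+y = trans (+-congʳ x≈z+y) (//-rightDividesʳ y z)

  inverse : ∀ {x} → x # 0# → ∃[ x⁻¹ ] x⁻¹ * x ≈ 1#
  inverse {x} x#0 with #⇒invertible x#0
  ... | x⁻¹ , inverseˡ , _ = x⁻¹ , trans (*-congˡ (sym (x-0≈x x))) inverseˡ

  *-cancelˡ-# : ∀ {x} → x # 0# → ∀ y z → x * y ≈ x * z → y ≈ z
  *-cancelˡ-# {x} x#0 y z xy≈xz with inverse x#0
  ... | x⁻¹ , x⁻¹x≈1 = begin
    y               ≈⟨ *-identityˡ y ⟨
    1# * y          ≈⟨ *-congʳ x⁻¹x≈1 ⟨
    x⁻¹ * x * y     ≈⟨ *-assoc _ _ _ ⟩
    x⁻¹ * (x * y)   ≈⟨ *-congˡ xy≈xz ⟩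
    x⁻¹ * (x * z)   ≈⟨ *-assoc _ _ _ ⟨
    x⁻¹ * x * z     ≈⟨ *-congʳ x⁻¹x≈1 ⟩
    1# * z          ≈⟨ *-identityˡ z ⟩
    z               ∎

  -- Convergent series

  IsSum-cong : ∀ {a b x y} → a ≋ b → x ≈ y → IsSum a x → IsSum b y
  IsSum-cong a≋b x≈y sum r with sum r
  ... | N , close = N , λ n N≤n → ≼-resp-≈ (+-cong (∑-cong n a≋b) (-‿cong x≈y)) (close n N≤n)

  IsSum-≼ : ∀ {a x r} → (∀ n → r ≼ a n) → IsSum a x → r ≼ x
  IsSum-≼ {a} {x} {r} r≼a sum with sum r
  ... | N , close = ≼-resp-≈ S-[S-x]≈x (≼-minus (≼-∑ N r≼a) (close N ℕ.≤-refl))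
    where
    S-[S-x]≈x : ∑ N a - (∑ N a - x) ≈ x
    S-[S-x]≈x = minus-intro (sym (trans (+-comm x _) (//-rightDividesˡ x (∑ N a))))

  IsSum-unique : ∀ {a x y} → IsSum a x → IsSum a y → x ≈ y
  IsSum-unique {a} {x} {y} sumx sumy = sym (x∙y⁻¹≈ε⇒x≈y y x (≼-separated close))
    where
    close : ∀ r → r ≼ y - x
    close r with sumx r | sumy r
    ... | N , closex | M , closey = ≼-resp-≈ telescope
          (≼-minus (closex (N ℕ.⊔ M) (ℕ.m≤m⊔n N M)) (closey (N ℕ.⊔ M) (ℕ.m≤n⊔m N M)))
      where
      S = ∑ (N ℕ.⊔ M) a
      telescope : (S - x) - (S - y) ≈ y - x
      telescope = minus-intro (sym (begin
        (y - x) + (S - y)   ≈⟨ solve 4 (λ y x′ S y′ → (y :+ x′) :+ (S :+ y′) := (S :+ x′) :+ (y :+ y′)) refl y (- x) S (- y) ⟩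
        (S - x) + (y - y)   ≈⟨ trans (+-congˡ (-‿inverseʳ y)) (+-identityʳ _) ⟩
        S - x               ∎))

  IsSum-* : ∀ {a x} c → IsSum a x → IsSum (c · a) (c * x)
  IsSum-* {a} {x} c sum r with ≼-inhabited c
  ... | s , s≼c with sum (r ℚ.- s)
  ...   | N , close = N , λ n N≤n → ≼-resp-≈
            (trans (distribˡ _ _ _) (+-cong (sym (∑-· n c a)) (sym (-‿distribʳ-* c x))))
            (≼-weaken (ℚ.≤-reflexive (≡.sym (s+[r-s]≡r))) (≼-* s≼c (close n N≤n)))
    where
    s+[r-s]≡r : s ℚ.+ (r ℚ.- s) ≡ r
    s+[r-s]≡r = ≡.trans (ℚ.+-comm s (r ℚ.- s)) (≡.trans (ℚ.+-assoc r (ℚ.- s) s)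
                  (≡.trans (≡.cong (r ℚ.+_) (ℚ.+-inverseˡ s)) (ℚ.+-identityʳ r)))

  IsSum-shift : ∀ {a x} → IsSum a x → IsSum (shift a) (x - a 0)
  IsSum-shift {a} {x} sum r with sum r
  ... | N , close = N , λ n N≤n → ≼-resp-≈ (lemma n) (close (suc n) (ℕ.m≤n⇒m≤1+n N≤n))
    where
    lemma : ∀ n → (a 0 + ∑ n (shift a)) - x ≈ ∑ n (shift a) - (x - a 0)
    lemma n = trans (solve 3 (λ a s x′ → (a :+ s) :+ x′ := s :+ (a :+ x′)) refl (a 0) (∑ n (shift a)) (- x))
                    (+-congˡ (sym (⁻¹-anti-homo-// x (a 0))))

  IsSum-X : ∀ x → IsSum (λ n → X n * x ^ n) x
  IsSum-X x r = 2 , λ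
    { zero          ()
    ; (suc zero)    (s≤s ())
    ; (suc (suc n)) _ → ≼-resp-≈ (sym (minus-intro (begin
        0# * 1# + (1# * (x * 1#) + ∑ n (λ k → 0# * (x * (x * x ^ k))))
          ≈⟨ +-congˡ (+-congˡ (∑-zero n (λ k → zeroˡ (x * (x * x ^ k))))) ⟩
        0# * 1# + (1# * (x * 1#) + 0#)
          ≈⟨ solve 1 (λ x → con 0 :* con 1 :+ (con 1 :* (x :* con 1) :+ con 0) := con 0 :+ x) refl x ⟩
        0# + x ∎))) (≼-0 r) }

  Bounded : (ℕ → Carrier) → Set
  Bounded g = ∃[ r ] ∀ k → r ≼ g k

  eventuallyBounded⇒bounded : ∀ {r} N {g} → (∀ k → N ℕ.≤ k → r ≼ g k) → Bounded g
  eventuallyBounded⇒bounded {r} zero    bound = r , λ k → bound k z≤n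
  eventuallyBounded⇒bounded (suc N) {g} bound
    with eventuallyBounded⇒bounded N (λ k N≤k → bound (suc k) (s≤s N≤k)) | ≼-inhabited (g 0)
  ... | r , r≼ | s , s≼ = (r ℚ.⊓ s) , λ
    { zero    → ≼-weaken (ℚ.p⊓q≤q r s) s≼
    ; (suc k) → ≼-weaken (ℚ.p⊓q≤p r s) (r≼ k) }

  -- Consecutive partial sums are eventually close to the same `x`, and `a n` is their difference;
  -- finitely many earlier terms only lower the bound.
  IsSum⇒bounded : ∀ {a x} → IsSum a x → Bounded a
  IsSum⇒bounded {a} {x} sum with sum 0ℚ
  ... | N , close = eventuallyBounded⇒bounded N λ n N≤n →
    ≼-resp-≈ (lemma n) (≼-minus (close (suc n) (ℕ.m≤n⇒m≤1+n N≤n)) (close n N≤n))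
    where
    lemma : ∀ n → (∑ (suc n) a - x) - (∑ n a - x) ≈ a n
    lemma n = minus-intro (trans (+-congʳ (∑-init-last n a))
      (solve 3 (λ s a x′ → (s :+ a) :+ x′ := a :+ (s :+ x′)) refl (∑ n a) (a n) (- x)))

  bounded-resp-≈ : ∀ {g h} → (∀ k → g k ≈ h k) → Bounded g → Bounded h
  bounded-resp-≈ g≈h (r , r≼) = r , λ k → ≼-resp-≈ (g≈h k) (r≼ k)

  bounded-const : ∀ x → Bounded (λ _ → x)
  bounded-const x with ≼-inhabited x
  ... | r , r≼x = r , λ _ → r≼x

  bounded-+ : ∀ {g h} → Bounded g → Bounded h → Bounded (λ k → g k + h k)
  bounded-+ (r , r≼) (s , s≼) = (r ℚ.⊓ s) , λ k →
    ≼-+ (≼-weaken (ℚ.p⊓q≤p r s) (r≼ k)) (≼-weaken (ℚ.p⊓q≤q r s) (s≼ k))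

  bounded-* : ∀ {g h} → Bounded g → Bounded h → Bounded (λ k → g k * h k)
  bounded-* (r , r≼) (s , s≼) = (r ℚ.+ s) , λ k → ≼-* (r≼ k) (s≼ k)

  -- Asymptotic expansions along the sequence π^m, π^(m+1), …, which tends to 0.

  module Expansions {π} (1≼π : 1ℚ ≼ π) (π#0 : π # 0#) where

    n≼πⁿ : ∀ n → fromℤ (+ n) ≼ π ^ n
    n≼πⁿ zero    = 0≼1
    n≼πⁿ (suc n) = ≼-weaken (ℚ.≤-reflexive (fromℤ-suc n)) (≼-* 1≼π (n≼πⁿ n))

    πⁿ#0 : ∀ n → π ^ n # 0#
    πⁿ#0 zero    = 1#0
    πⁿ#0 (suc n) = x#0y#0→xy#0 π#0 (πⁿ#0 n)

    fromℤ-nonNeg : ∀ n → 0ℚ ℚ.≤ fromℤ (+ n)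
    fromℤ-nonNeg n = ℚ.nonNegative⁻¹ (fromℤ (+ n)) {{ℚ.normalize-nonNeg n 1}}

    0≼πⁿ : ∀ n → 0ℚ ≼ π ^ n
    0≼πⁿ n = ≼-weaken (fromℤ-nonNeg n) (n≼πⁿ n)

    module _ (m : ℕ) where

      -- The offset `m` allows an initial stretch of the sequence to be dropped, in particular
      -- points where a denominator may vanish.
      point : ℕ → Carrier
      point k = π ^ (m ℕ.+ k)

      k≼point : ∀ k → fromℤ (+ k) ≼ point k
      k≼point k = ≼-resp-≈ (sym (^-homo-* π m k))
        (≼-weaken (ℚ.≤-reflexive (≡.sym (ℚ.+-identityˡ (fromℤ (+ k))))) (≼-* (0≼πⁿ m) (n≼πⁿ k)))

      -- g has an expansion f 0 + f 1 x + … + O (xᴺ) at the points x = point k.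
      Expansion : ℕ → (ℕ → Carrier) → Series → Set (c ⊔ ℓ₁)
      Expansion zero    g f = Lift (c ⊔ ℓ₁) (Bounded g)
      Expansion (suc N) g f = ∃[ h ] (∀ k → g k ≈ f 0 + point k * h k) × Expansion N h (shift f)

      expansion-resp-≈ : ∀ N {g g′ f} → (∀ k → g k ≈ g′ k) → Expansion N g f → Expansion N g′ f
      expansion-resp-≈ zero    g≈g′ (lift b) = lift (bounded-resp-≈ g≈g′ b)
      expansion-resp-≈ (suc N) g≈g′ (h , eq , e)   = h , (λ k → trans (sym (g≈g′ k)) (eq k)) , e

      expansion⇒bounded : ∀ N {g f} → Expansion N g f → Bounded g
      expansion⇒bounded zero    (lift b)     = b
      expansion⇒bounded (suc N) {f = f} (h , eq , e) = bounded-resp-≈ (sym ∘ eq)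
        (bounded-+ (bounded-const (f 0)) (bounded-* (0ℚ , λ k → 0≼πⁿ (m ℕ.+ k)) (expansion⇒bounded N e)))

      expansion-weaken : ∀ N {g f} → Expansion (suc N) g f → Expansion N g f
      expansion-weaken zero    {f = f} e    = lift (expansion⇒bounded 1 {f = f} e)
      expansion-weaken (suc N) (h , eq , e) = h , eq , expansion-weaken N e

      expansion-⊕ : ∀ N {g g′ f f′} → Expansion N g f → Expansion N g′ f′ →
                    Expansion N (λ k → g k + g′ k) (f ⊕ f′)
      expansion-⊕ zero    (lift b) (lift b′) = lift (bounded-+ b b′)
      expansion-⊕ (suc N) (h , eq , e) (h′ , eq′ , e′) = (λ k → h k + h′ k) ,
        (λ k → trans (+-cong (eq k) (eq′ k))
          (solve 5 (λ a x b c d → (a :+ x :* b) :+ (c :+ x :* d) := (a :+ c) :+ x :* (b :+ d)) refl _ _ _ _ _)) ,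
        expansion-⊕ N e e′

      expansion-· : ∀ N a {g f} → Expansion N g f → Expansion N (λ k → a * g k) (a · f)
      expansion-· zero    a (lift b) = lift (bounded-* (bounded-const a) b)
      expansion-· (suc N) a (h , eq , e)   = (λ k → a * h k) ,
        (λ k → trans (*-congˡ (eq k))
          (solve 4 (λ a b x c → a :* (b :+ x :* c) := a :* b :+ x :* (a :* c)) refl _ _ _ _)) ,
        expansion-· N a e

      -- The remainder `f 0 h′ + h g′` follows the recursion of `⊛`. It needs `g′` itself only to
      -- order `N`, hence the weakening.
      expansion-⊛ : ∀ N {g g′ f f′} → Expansion N g f → Expansion N g′ f′ →
                    Expansion N (λ k → g k * g′ k) (f ⊛ f′)
      expansion-⊛ zero (lift b) (lift b′) = lift (bounded-* b b′)
      expansion-⊛ (suc N) {g} {g′} {f} {f′} (h , eq , e) e′@(h′ , eq′ , e′₁) =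
        (λ k → f 0 * h′ k + h k * g′ k) ,
        (λ k → begin
          g k * g′ k
            ≈⟨ *-congʳ (eq k) ⟩
          (f 0 + point k * h k) * g′ k
            ≈⟨ distribʳ _ _ _ ⟩
          f 0 * g′ k + point k * h k * g′ k
            ≈⟨ +-congʳ (*-congˡ (eq′ k)) ⟩
          f 0 * (f′ 0 + point k * h′ k) + point k * h k * g′ k
            ≈⟨ solve 6 (λ a b x c d e → a :* (b :+ x :* c) :+ x :* d :* e := a :* b :+ x :* (a :* c :+ d :* e)) refl
                 (f 0) (f′ 0) (point k) (h′ k) (h k) (g′ k) ⟩
          f 0 * f′ 0 + point k * (f 0 * h′ k + h k * g′ k) ∎) ,
        expansion-⊕ N (expansion-· N (f 0) e′₁) (expansion-⊛ N e (expansion-weaken N e′))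

      -- `f 0 - f′ 0` is `point k` times a bounded quantity for every `k`, so it is 0. The points
      -- are invertible, so the remainders then coincide and the argument repeats one degree higher.
      expansion-unique : ∀ {g f f′} N → Expansion (suc N) g f → Expansion (suc N) g f′ → f N ≈ f′ N
      expansion-unique {g} {f} {f′} N E@(h , eq , e) E′@(h′ , eq′ , e′) = by N e e′
        where
        f₀≈f′₀ : f 0 ≈ f′ 0
        f₀≈f′₀ with bounded-+ (expansion⇒bounded N e′) (bounded-* (bounded-const (- 1#)) (expansion⇒bounded N e))
        ... | r , r≼ = x∙y⁻¹≈ε⇒x≈y _ _ (≼-separated small)
          where
          difference : ∀ k → point k * (h′ k + - 1# * h k) ≈ f 0 - f′ 0
          difference k = sym (minus-intro (begin
            f 0                                                           ≈⟨ //-rightDividesʳ (point k * h k) (f 0) ⟨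
            f 0 + point k * h k - point k * h k                           ≈⟨ +-cong (trans (sym (eq k)) (eq′ k)) (sym (-1*x≈-x _)) ⟩
            f′ 0 + point k * h′ k + - 1# * (point k * h k)
              ≈⟨ solve 5 (λ b x d i a → b :+ x :* d :+ i :* (x :* a) := x :* (d :+ i :* a) :+ b) refl _ _ _ _ _ ⟩
            point k * (h′ k + - 1# * h k) + f′ 0                          ∎))
          small : ∀ s → s ≼ f 0 - f′ 0
          small s with archimedean (s ℚ.- r)
          ... | k , s-r≤k = ≼-resp-≈ (difference k) (≼-weaken s≤k+r (≼-* (k≼point k) (r≼ k)))
            where
            s≤k+r : s ℚ.≤ fromℤ (+ k) ℚ.+ r
            s≤k+r = ℚ.≤-trans (ℚ.≤-reflexive (≡.sym (ℚ-rightDividesˡ r s))) (ℚ.+-monoˡ-≤ r s-r≤k)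
        h≈h′ : ∀ k → h k ≈ h′ k
        h≈h′ k = *-cancelˡ-# (πⁿ#0 (m ℕ.+ k)) _ _ (+-cancelˡ (f 0) _ _
          (trans (sym (eq k)) (trans (eq′ k) (+-congʳ (sym f₀≈f′₀)))))
        by : ∀ N → Expansion N h (shift f) → Expansion N h′ (shift f′) → f N ≈ f′ N
        by zero    _ _  = f₀≈f′₀
        by (suc N) e e′ = expansion-unique {f = shift f} {shift f′} N e (expansion-resp-≈ (suc N) {f = shift f′} (sym ∘ h≈h′) e′)

      -- Removing the constant term and dividing by the point leaves a convergent series, so only
      -- boundedness is at stake. The terms at `point k` are those at `point 0` times integral
      -- factors, so convergence at `point 0` alone bounds all values uniformly.
      IsSum⇒expansion : ∀ N {g f} → (∀ k → IsSum (λ n → f n * point k ^ n) (g k)) → Expansion N g f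
      IsSum⇒expansion zero {g} {f} sum with IsSum⇒bounded (sum 0)
      ... | r , r≼ = lift (r , λ k → IsSum-≼ (bound k) (sum k))
        where
        bound : ∀ k n → r ≼ f n * point k ^ n
        bound k n = ≼-resp-≈ (begin
          f n * point 0 ^ n * (π ^ k) ^ n       ≈⟨ *-assoc _ _ _ ⟩
          f n * (point 0 ^ n * (π ^ k) ^ n)     ≈⟨ *-congˡ (^-distrib-* (point 0) (π ^ k) n) ⟨
          f n * (point 0 * π ^ k) ^ n           ≈⟨ *-congˡ (^-congˡ n (^-homo-* π (m ℕ.+ 0) k)) ⟨
          f n * (π ^ (m ℕ.+ 0 ℕ.+ k)) ^ n       ≡⟨ ≡.cong (λ i → f n * (π ^ (i ℕ.+ k)) ^ n) (ℕ.+-identityʳ m) ⟩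
          f n * point k ^ n                     ∎)
          (≼-weaken (ℚ.≤-reflexive (≡.sym (ℚ.+-identityʳ r))) (≼-* (r≼ n) 0≼[πᵏ]ⁿ))
          where
          0≼[πᵏ]ⁿ : 0ℚ ≼ (π ^ k) ^ n
          0≼[πᵏ]ⁿ = ≼-resp-≈ (sym (^-assocʳ π k n)) (0≼πⁿ (k ℕ.* n))
      IsSum⇒expansion (suc N) {g} {f} sum = h , eq , IsSum⇒expansion N sum′
        where
        x⁻¹ h : ℕ → Carrier
        x⁻¹ k = proj₁ (inverse (πⁿ#0 (m ℕ.+ k)))
        h k = x⁻¹ k * (g k - f 0 * 1#)
        x⁻¹x≈1 : ∀ k → x⁻¹ k * point k ≈ 1#
        x⁻¹x≈1 k = proj₂ (inverse (πⁿ#0 (m ℕ.+ k)))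
        eq : ∀ k → g k ≈ f 0 + point k * h k
        eq k = begin
          g k                                                 ≈⟨ //-rightDividesˡ (f 0 * 1#) (g k) ⟨
          (g k - f 0 * 1#) + f 0 * 1#                         ≈⟨ +-cong (sym (trans (*-congʳ (x⁻¹x≈1 k)) (*-identityˡ _))) (*-identityʳ _) ⟩
          x⁻¹ k * point k * (g k - f 0 * 1#) + f 0
            ≈⟨ solve 4 (λ i x d a → i :* x :* d :+ a := a :+ x :* (i :* d)) refl _ _ _ _ ⟩
          f 0 + point k * h k                                 ∎
        sum′ : ∀ k → IsSum (λ n → f (suc n) * point k ^ n) (h k)
        sum′ k = IsSum-cong (λ n → begin
          x⁻¹ k * (f (suc n) * (point k * point k ^ n))
            ≈⟨ solve 4 (λ i a x y → i :* (a :* (x :* y)) := (i :* x) :* (a :* y)) refl _ _ _ _ ⟩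
          x⁻¹ k * point k * (f (suc n) * point k ^ n)         ≈⟨ trans (*-congʳ (x⁻¹x≈1 k)) (*-identityˡ _) ⟩
          f (suc n) * point k ^ n                             ∎)
          refl (IsSum-* {λ n → f (suc n) * point k ^ suc n} (x⁻¹ k) (IsSum-shift {λ n → f n * point k ^ n} (sum k)))

      -- If `g` vanished at a late point, `f 0` would equal minus the remainder term there, which is
      -- too small.
      expansion-#0 : ∀ {g f} → f 0 # 0# → Expansion 1 g f → ∃[ k₀ ] ∀ k → g (k₀ ℕ.+ k) # 0#
      expansion-#0 {g} {f} f₀#0 (h , eq , lift (r , r≼)) with v-#0⁺ f₀#0
      ... | s , vf₀≡s with archimedean ((s ℚ.+ 1ℚ) ℚ.- r)
      -- From `k₀` on, `point k * h k` has valuation at least `s + 1`, where `s` is the valuation of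
      -- `f 0`.
      ...   | k₀ , large = k₀ , nonvanishing
        where
        nonvanishing : ∀ k → g (k₀ ℕ.+ k) # 0#
        nonvanishing k with #0⊎≈0 (g (k₀ ℕ.+ k))
        ... | inj₁ g#0 = g#0
        ... | inj₂ g≈0 = contradiction s+1≤s (p+1≰p s)
          where
          n = k₀ ℕ.+ k
          s+1≤n+r : s ℚ.+ 1ℚ ℚ.≤ fromℤ (+ n) ℚ.+ r
          s+1≤n+r = ℚ.≤-trans (ℚ.≤-reflexive (≡.sym (ℚ-rightDividesˡ r (s ℚ.+ 1ℚ))))
            (ℚ.+-monoˡ-≤ r (ℚ.≤-trans large (ℚ.≤-trans
              (ℚ.≤-trans (ℚ.≤-reflexive (≡.sym (ℚ.+-identityʳ (fromℤ (+ k₀))))) (ℚ.+-monoʳ-≤ (fromℤ (+ k₀)) (fromℤ-nonNeg k))) (ℚ.≤-reflexive (≡.sym (fromℤ-+ (+ k₀) (+ k)))))))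
          s+1≼f₀ : s ℚ.+ 1ℚ ≼ f 0
          s+1≼f₀ = ≼-resp-≈ (sym (begin
            f 0                                ≈⟨ //-rightDividesʳ (point n * h n) (f 0) ⟨
            f 0 + point n * h n - point n * h n ≈⟨ +-congʳ (trans (sym (eq n)) g≈0) ⟩
            0# - point n * h n                 ≈⟨ +-identityˡ _ ⟩
            - (point n * h n)                  ∎))
            (≼-neg (≼-weaken s+1≤n+r (≼-* (k≼point n) (r≼ n))))
          s+1≤s : s ℚ.+ 1ℚ ℚ.≤ s
          s+1≤s = [≤]-injective (≡.subst ([ s ℚ.+ 1ℚ ] ≤⁺_) vf₀≡s s+1≼f₀)

      expansion-zero : ∀ N {f} → (∀ n → f n ≈ 0#) → Expansion N (λ _ → 0#) f
      expansion-zero zero    f≋0 = lift (bounded-const 0#)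
      expansion-zero (suc N) f≋0 = (λ _ → 0#) ,
        (λ k → sym (trans (+-cong (f≋0 0) (zeroʳ _)) (+-identityˡ 0#))) , expansion-zero N (f≋0 ∘ suc)

      expansion-const : ∀ N a → Expansion N (λ _ → a) (a · δ)
      expansion-const zero    a = lift (bounded-const a)
      expansion-const (suc N) a = (λ _ → 0#) ,
        (λ k → sym (trans (+-cong (*-identityʳ a) (zeroʳ _)) (+-identityʳ a))) , expansion-zero N (λ _ → zeroʳ a)

    -- With `z` the quotient, the values satisfy `q z E = num + z`. Both sides are expanded along
    -- the points where the denominator is nonzero, and uniqueness compares coefficients.
    functionalEquation : ∀ {q s e l F} → q - 1# # 0# → e 0 ≈ 1# → (E L : ℕ → Carrier) →
      (∀ k → IsSum (λ n → e n * (π ^ suc k) ^ n) (E k)) →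
      (∀ k → IsSum (λ n → l n * (π ^ suc k) ^ n) (L k)) →
      (∀ k z → IsQuotient ((q - 1#) + s * L k) (q * E k - 1#) z → IsSum (λ n → F n * (π ^ suc k) ^ n) z) →
      q · (F ⊛ e) ≋ ((q - 1#) · δ ⊕ s · l) ⊕ F
    functionalEquation {q} {s} {e} {l} {F} q-1#0 e₀≈1 E L sumE sumL sumF = λ n →
      expansion-unique m {f = q · (F ⊛ e)} {((q - 1#) · δ ⊕ s · l) ⊕ F} n (left (suc n)) (right (suc n))
      where
      denominator : ℕ → Carrier
      denominator k = q * E k - 1#

      denominator-expansion : Expansion 1 1 denominator (q · e ⊕ (- 1#) · δ)
      denominator-expansion = expansion-⊕ 1 1 {f = q · e} {(- 1#) · δ}
        (expansion-· 1 1 q {f = e} (IsSum⇒expansion 1 1 {f = e} sumE)) (expansion-const 1 1 (- 1#))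

      denominator-#0 : ∃[ k₀ ] ∀ k → denominator (k₀ ℕ.+ k) # 0#
      denominator-#0 = expansion-#0 1 {f = q · e ⊕ (- 1#) · δ}
        (#-congʳ (+-cong (sym (trans (*-congˡ e₀≈1) (*-identityʳ q))) (sym (*-identityʳ _))) q-1#0) denominator-expansion

      k₀ m : ℕ
      k₀ = proj₁ denominator-#0
      -- With this offset `point m k` reduces to `π ^ suc (k₀ + k)`, the form of the points in the
      -- hypotheses.
      m = suc k₀

      num den den⁻¹ z : ℕ → Carrier
      num k = (q - 1#) + s * L (k₀ ℕ.+ k)
      den k = denominator (k₀ ℕ.+ k)
      den⁻¹ k = proj₁ (inverse (proj₂ denominator-#0 k))
      z k = den⁻¹ k * num k

      z-den : ∀ k → z k * den k ≈ num k
      z-den k = begin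
        den⁻¹ k * num k * den k     ≈⟨ solve 3 (λ i a d → i :* a :* d := i :* d :* a) refl _ _ _ ⟩
        den⁻¹ k * den k * num k     ≈⟨ *-congʳ (proj₂ (inverse (proj₂ denominator-#0 k))) ⟩
        1# * num k                  ≈⟨ *-identityˡ _ ⟩
        num k                       ∎

      z-expansion : ∀ N → Expansion m N z F
      z-expansion N = IsSum⇒expansion m N λ k → sumF (k₀ ℕ.+ k) (z k) (proj₂ denominator-#0 k , z-den k)

      left : ∀ N → Expansion m N (λ k → q * (z k * E (k₀ ℕ.+ k))) (q · (F ⊛ e))
      left N = expansion-· m N q {f = F ⊛ e} (expansion-⊛ m N {f = F} {e} (z-expansion N)
        (IsSum⇒expansion m N {f = e} λ k → sumE (k₀ ℕ.+ k)))

      right : ∀ N → Expansion m N (λ k → q * (z k * E (k₀ ℕ.+ k))) (((q - 1#) · δ ⊕ s · l) ⊕ F)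
      right N = expansion-resp-≈ m N {f = ((q - 1#) · δ ⊕ s · l) ⊕ F} identity
        (expansion-⊕ m N {f = (q - 1#) · δ ⊕ s · l} {F}
          (expansion-⊕ m N {f = (q - 1#) · δ} {s · l} (expansion-const m N (q - 1#))
            (expansion-· m N s {f = l} (IsSum⇒expansion m N {f = l} λ k → sumL (k₀ ℕ.+ k))))
          (z-expansion N))
        where
        identity : ∀ k → num k + z k ≈ q * (z k * E (k₀ ℕ.+ k))
        identity k = begin
          num k + z k                                        ≈⟨ +-cong (z-den k) (*-identityʳ _) ⟨
          z k * den k + z k * 1#                             ≈⟨ distribˡ _ _ _ ⟨
          z k * (den k + 1#)                                 ≈⟨ *-congˡ (//-rightDividesˡ 1# _) ⟩
          z k * (q * E (k₀ ℕ.+ k))                           ≈⟨ solve 3 (λ z q e → z :* (q :* e) := q :* (z :* e)) refl _ _ _ ⟩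
          q * (z k * E (k₀ ℕ.+ k))                           ∎

-- The radius of the disc for odd primes

1/n<1 : ∀ n .{{_ : ℕ.NonZero n}} → 2 ℕ.≤ n → (+ 1 ℚ./ n) ℚ.< 1ℚ
1/n<1 n@(suc _) 2≤n = ℚ.toℚᵘ-cancel-< (ℚᵘ.<-respˡ-≃ (ℚᵘ.≃-sym (toℚᵘ-/ (+ 1) n))
  (*<* (ℤ.+<+ (≡.subst (2 ℕ.≤_) (≡.sym (ℕ.*-identityˡ n)) 2≤n))))

-- Oddness of `p` enters here: for `p = 2` the bound is 1, and `p` itself lies on the boundary of
-- the disc.
1/[p-1]<1 : ∀ {p} (pPrime : Prime p) → p ≢ 2 → 1/[p-1] pPrime ℚ.< 1ℚ
1/[p-1]<1 {0}                 pPrime p≢2 = contradiction pPrime ¬prime[0]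
1/[p-1]<1 {1}                 pPrime p≢2 = contradiction pPrime ¬prime[1]
1/[p-1]<1 {2}                 pPrime p≢2 = contradiction ≡.refl p≢2
1/[p-1]<1 {suc (suc (suc p))} (prime _) p≢2 = 1/n<1 (suc (suc p)) (s≤s (s≤s z≤n))

prime∤1 : ∀ {p} → Prime p → p ∤ 1
prime∤1 pPrime p∣1 with ∣1⇒≡1 p∣1
... | ≡.refl = ¬prime[1] pPrime

-- Comparison of the two families over ℂₚ

module PAdicProperties {c ℓ₁ ℓ₂} {p : ℕ} (pPrime : Prime p) (p≢2 : p ≢ 2) (cp : PAdicComplexNumbers p c ℓ₁ ℓ₂) where
  open Product using (_×_)
  open PAdicAnalysis pPrime cp
  open PAdicComplexNumbers cp using (pAdicValuation; ℚₚ-completion; ℚₚᵃ-closure; ℂₚ-completion)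
  private
    module v = PAdicValuation pAdicValuation
    module ι₁ = Completion ℚₚ-completion
    module ι₂ = AlgebraicClosure ℚₚᵃ-closure
    module ι₃ = Completion ℂₚ-completion
  open ValuedFieldProperties ℂₚ
  open HeytingProperties (ValuedField.heytingCommutativeRing ℂₚ) using (#-congʳ)
  open CommutativeRing commutativeRing using (ring; commutativeSemiring; +-abelianGroup)
  open RingProperties ring using (-‿distribˡ-*)
  open AbelianGroupProperties +-abelianGroup using (//-rightDividesˡ)
  open CommutativeExp commutativeSemiring using (^-distrib-*)
  open Exp semiring using (^-congˡ)
  open Sum semiring using (sum-cong-≋)
  open PowerSeries commutativeRing hiding (_^_)
  open Solver commutativeSemiring using (solve; _:+_; _:*_; _:=_)
  open SetoidReasoning setoid

  fromℚ-isRingHomomorphism : IsRingHomomorphism (CommutativeRing.rawRing ℚ.+-*-commutativeRing) rawRing fromℚ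
  fromℚ-isRingHomomorphism = Composition.isRingHomomorphism trans
    (Composition.isRingHomomorphism (ValuedField.trans (PAdicComplexNumbers.ℚₚᵃ cp)) ι₁.isRingHomomorphism ι₂.isRingHomomorphism)
    ι₃.isRingHomomorphism

  open IsRingHomomorphism fromℚ-isRingHomomorphism using (*-homo; 1#-homo; 0#-homo; -‿homo)

  open SeriesHomomorphism ℚ.+-*-commutativeRing commutativeRing fromℚ-isRingHomomorphism

  v-fromℚ : ∀ x → v (fromℚ x) ≡ v.v x
  v-fromℚ x = ≡.trans (ι₃.v-ι _) (≡.trans (ι₂.v-ι _) (ι₁.v-ι x))

  π : Carrier
  π = fromℚ (fromℤ (+ p))

  v-π : v π ≡ [ 1ℚ ]
  v-π = ≡.trans (v-fromℚ _) (≡.trans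
    (≡.cong (λ k → v.v (fromℤ (+ k))) (≡.sym (≡.trans (ℕ.*-identityʳ _) (ℕ.^-identityʳ p))))
    (v.v-ℕ 1 1 (prime∤1 pPrime)))

  1≼π : 1ℚ ≼ π
  1≼π = ≡.subst ([ 1ℚ ] ≤⁺_) (≡.sym v-π) [ ℚ.≤-refl ]

  π#0 : π # 0#
  π#0 = Equivalence.from (v-#0 π) (1ℚ , v-π)

  open Expansions 1≼π π#0

  πⁿ∈disc : ∀ k → InDisc (π ^ suc k)
  πⁿ∈disc k = <-≼ (1/[p-1]<1 pPrime p≢2) (≼-* 1≼π (0≼πⁿ k))
    where
    <-≼ : ∀ {r x} → r ℚ.< 1ℚ → 1ℚ ≼ x → [ r ] <⁺ v x
    <-≼ {r} {x} r<1 1≼x with v x | 1≼x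
    ... | [ s ] | [ 1≤s ] = [ ℚ.<-≤-trans r<1 1≤s ]
    ... | ⊤⁺    | _       = [ r ]<⊤⁺

  -- The definitions provide only that `log q` is nonzero, while the argument divides by `q - 1`. If
  -- `q = 1`, every term of the logarithm series is 0.
  log-#0 : ∀ {q logq} → IsLog q logq → logq # 0# → q - 1# # 0#
  log-#0 {q} {logq} isLog logq#0 with #0⊎≈0 (q - 1#)
  ... | inj₁ q-1#0 = q-1#0
  ... | inj₂ q-1≈0 = contradiction (#-congʳ logq≈0 logq#0) ¬0#0
    where
    term≈0 : ∀ n → fromℚ (logCoeff n) * (q - 1#) ^ n ≈ 0#
    term≈0 zero    = trans (*-congʳ 0#-homo) (zeroˡ _)
    term≈0 (suc n) = trans (*-congˡ (trans (*-congʳ q-1≈0) (zeroˡ _))) (zeroʳ _)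
    logq≈0 : logq ≈ 0#
    logq≈0 = ≼-separated λ r → IsSum-≼ {λ n → fromℚ (logCoeff n) * (q - 1#) ^ n} (λ n → ≼-resp-≈ (sym (term≈0 n)) (≼-0 r)) isLog

  -- Each family comes with its own logarithm of `q` and its own quotient `s`; this identifies them.
  quotient-unique : ∀ {x y y′ z z′} → y ≈ y′ → IsQuotient x y z → IsQuotient x y′ z′ → z ≈ z′
  quotient-unique y≈y′ (y#0 , zy≈x) (_ , z′y′≈x) = *-cancelˡ-# y#0 _ _
    (trans (*-comm _ _) (trans zy≈x (trans (sym z′y′≈x) (trans (*-congˡ (sym y≈y′)) (*-comm _ _)))))

  two half -¼′ -4′ : Carrier
  two  = fromℚ (fromℤ (+ 2))
  half = fromℚ ½
  -¼′  = fromℚ -¼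
  -4′  = fromℚ (ℚ.- fromℤ (+ 4))

  expSeries sqrtSeries logSeries : Series
  expSeries  = fromℚ ∘ 1/_!
  sqrtSeries = fromℚ ∘ sqrtCoeff
  logSeries  = fromℚ ∘ logCoeff

  D-exp : D expSeries ≋ expSeries
  D-exp n = trans (sym (D-homo 1/_! n)) (reflexive (≡.cong fromℚ (D-1/! n)))

  two*half : two * half ≈ 1#
  two*half = trans (sym (*-homo (fromℤ (+ 2)) ½)) 1#-homo

  -¼*-4 : -¼′ * -4′ ≈ 1#
  -¼*-4 = trans (sym (*-homo -¼ (ℚ.- fromℤ (+ 4)))) 1#-homo

  2M : Series → Series
  2M f = two · M f

  2M-isDerivation : IsDerivation 2M
  2M-isDerivation = ·-isDerivation two M-isDerivation

  -- The binomial series of exponent ½ has eigenvalue ½ under `M`, and the factor 2 makes it 1, as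
  -- befits `√(1 + x) = eᵘ`.
  2M-sqrt : 2M sqrtSeries ≋ sqrtSeries
  2M-sqrt n = begin
    two * M sqrtSeries n              ≈⟨ *-congˡ (M-homo sqrtCoeff n) ⟨
    two * fromℚ (ℚSeries.M sqrtCoeff n) ≡⟨ ≡.cong (λ x → two * fromℚ x) (M-binom ½ n) ⟩
    two * fromℚ (½ ℚ.* sqrtCoeff n)   ≈⟨ *-congˡ (*-homo ½ (sqrtCoeff n)) ⟩
    two * (half * sqrtSeries n)       ≈⟨ *-assoc _ _ _ ⟨
    two * half * sqrtSeries n         ≈⟨ trans (*-congʳ two*half) (*-identityˡ _) ⟩
    sqrtSeries n                      ∎

  2M-log : 2M (half · logSeries) ≋ δ
  2M-log n = begin
    two * M (half · logSeries) n      ≈⟨ *-congˡ (IsDerivation.·-homo M-isDerivation half logSeries n) ⟩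
    two * (half * M logSeries n)      ≈⟨ trans (sym (*-assoc _ _ _)) (trans (*-congʳ two*half) (*-identityˡ _)) ⟩
    M logSeries n                     ≈⟨ M-homo logCoeff n ⟨
    fromℚ (ℚSeries.M logCoeff n)      ≡⟨ ≡.cong fromℚ (M-logCoeff n) ⟩
    fromℚ (ℚSeries.δ n)               ≈⟨ δ-homo n ⟩
    δ n                               ∎

  2Mδ≋0 : ∀ n → 2M δ n ≈ 0#
  2Mδ≋0 n = trans (*-congˡ (Mδ≋0 n)) (zeroʳ two)

  -¼ⁿ*-4ⁿ : ∀ n → -¼′ ^ n * -4′ ^ n ≈ 1#
  -¼ⁿ*-4ⁿ n = begin
    -¼′ ^ n * -4′ ^ n     ≈⟨ ^-distrib-* -¼′ -4′ n ⟨
    (-¼′ * -4′) ^ n       ≈⟨ ^-congˡ n -¼*-4 ⟩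
    1# ^ n                ≈⟨ 1^n n ⟩
    1#                    ∎
    where
    1^n : ∀ n → 1# ^ n ≈ 1#
    1^n zero    = refl
    1^n (suc n) = trans (*-identityˡ _) (1^n n)

  rescale-inverse : ∀ f → rescale -¼′ (rescale -4′ f) ≋ f
  rescale-inverse f n = trans (sym (*-assoc _ _ _)) (trans (*-congʳ (-¼ⁿ*-4ⁿ n)) (*-identityˡ _))

  rescale-δ : ∀ a → rescale a δ ≋ δ
  rescale-δ a zero    = *-identityˡ _
  rescale-δ a (suc n) = zeroʳ _

  -4x : ∀ x → (1# - fromℚ (fromℤ (+ 4)) * x) - 1# ≈ -4′ * x
  -4x x = minus-intro (trans (+-comm _ _) (+-congʳ
    (trans (-‿distribˡ-* _ _) (*-congʳ (sym (-‿homo (fromℤ (+ 4))))))))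

  -4x-term : ∀ (f : ℕ → ℚ) x n → fromℚ (f n) * ((1# - fromℚ (fromℤ (+ 4)) * x) - 1#) ^ n
                               ≈ rescale -4′ (fromℚ ∘ f) n * x ^ n
  -4x-term f x n = begin
    fromℚ (f n) * ((1# - fromℚ (fromℤ (+ 4)) * x) - 1#) ^ n
      ≈⟨ *-congˡ (trans (^-congˡ n (-4x x)) (^-distrib-* -4′ x n)) ⟩
    fromℚ (f n) * (-4′ ^ n * x ^ n)
      ≈⟨ solve 3 (λ a b c → a :* (b :* c) := b :* a :* c) refl _ _ _ ⟩
    -4′ ^ n * fromℚ (f n) * x ^ n ∎

  qBernoulli-equation : ∀ {q s} (B : Series) → q - 1# # 0# →
    (∀ t → InDisc t → ∃[ eᵗ ] IsExp t eᵗ ×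
      (∀ z → IsQuotient ((q - 1#) + s * t) (q * eᵗ - 1#) z → IsSum (λ n → B n * (fromℚ (1/ n !) * t ^ n)) z)) →
    q · ((λ n → B n * expSeries n) ⊛ expSeries) ≋ ((q - 1#) · δ ⊕ s · X) ⊕ (λ n → B n * expSeries n)
  qBernoulli-equation B q-1#0 expand = functionalEquation {e = expSeries} {X} {λ n → B n * expSeries n} q-1#0 1#-homo
    (λ k → proj₁ (at k)) (λ k → π ^ suc k)
    (λ k → proj₁ (proj₂ (at k)))
    (λ k → IsSum-X (π ^ suc k))
    (λ k z quotient → IsSum-cong {λ n → B n * (fromℚ (1/ n !) * (π ^ suc k) ^ n)} {λ n → B n * expSeries n * (π ^ suc k) ^ n}
                        (λ n → sym (*-assoc (B n) (expSeries n) ((π ^ suc k) ^ n))) (refl {z}) (proj₂ (proj₂ (at k)) z quotient))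
    where at = λ k → expand (π ^ suc k) (πⁿ∈disc k)

  -- Along the points `t` the equation comes out with logarithm and root rescaled by `-4`. Rescaling
  -- by `-¼`, which respects products, passes to `x = -4t` and moves the factor onto `d`.
  dNumbers-equation : ∀ {q s} (d : Series) → q - 1# # 0# →
    (∀ t → InDisc t →
      let 1-4t = 1# - fromℚ (fromℤ (+ 4)) * t in
      ∃[ log[1-4t] ] IsLog 1-4t log[1-4t] ×
      ∃[ √[1-4t] ] IsSqrt 1-4t √[1-4t] ×
      (∀ z → IsQuotient ((q - 1#) + s * (fromℚ ½ * log[1-4t])) (q * √[1-4t] - 1#) z →
             IsSum (λ n → d n * t ^ n) z)) →
    q · (rescale -¼′ d ⊛ sqrtSeries) ≋ ((q - 1#) · δ ⊕ s · (half · logSeries)) ⊕ rescale -¼′ d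
  dNumbers-equation {q} {s} d q-1#0 expand n = begin
    q * (rescale -¼′ d ⊛ sqrtSeries) n
      ≈⟨ *-congˡ (⊛-cong {f = rescale -¼′ d} (λ _ → refl) (λ k → sym (rescale-inverse sqrtSeries k)) n) ⟩
    q * (rescale -¼′ d ⊛ rescale -¼′ (rescale -4′ sqrtSeries)) n
      ≈⟨ *-congˡ (rescale-⊛ -¼′ d (rescale -4′ sqrtSeries) n) ⟩
    q * (-¼′ ^ n * (d ⊛ rescale -4′ sqrtSeries) n)
      ≈⟨ solve 3 (λ a b c → a :* (b :* c) := b :* (a :* c)) refl _ _ _ ⟩
    -¼′ ^ n * (q * (d ⊛ rescale -4′ sqrtSeries) n)
      ≈⟨ *-congˡ (equation n) ⟩
    -¼′ ^ n * (((q - 1#) * δ n + s * (half * rescale -4′ logSeries n)) + d n)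
      ≈⟨ solve 7 (λ x a δ s h l d → x :* ((a :* δ :+ s :* (h :* l)) :+ d) := (a :* (x :* δ) :+ s :* (h :* (x :* l))) :+ x :* d)
           refl _ _ _ _ _ _ _ ⟩
    ((q - 1#) * rescale -¼′ δ n + s * (half * rescale -¼′ (rescale -4′ logSeries) n)) + rescale -¼′ d n
      ≈⟨ +-congʳ (+-cong (*-congˡ (rescale-δ -¼′ n)) (*-congˡ (*-congˡ (rescale-inverse logSeries n)))) ⟩
    (((q - 1#) · δ ⊕ s · (half · logSeries)) ⊕ rescale -¼′ d) n ∎
    where
    at = λ k → expand (π ^ suc k) (πⁿ∈disc k)
    equation : q · (d ⊛ rescale -4′ sqrtSeries) ≋ ((q - 1#) · δ ⊕ s · (half · rescale -4′ logSeries)) ⊕ d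
    equation = functionalEquation {e = rescale -4′ sqrtSeries} {half · rescale -4′ logSeries} {d} q-1#0
      (trans (*-identityˡ _) 1#-homo)
      (λ k → proj₁ (proj₂ (proj₂ (at k)))) (λ k → half * proj₁ (at k))
      (λ k → IsSum-cong (-4x-term sqrtCoeff (π ^ suc k)) refl (proj₁ (proj₂ (proj₂ (proj₂ (at k))))))
      (λ k → IsSum-cong (λ n → trans (*-congˡ (-4x-term logCoeff (π ^ suc k) n)) (sym (*-assoc _ _ _))) refl
               (IsSum-* {λ n → fromℚ (logCoeff n) * ((1# - fromℚ (fromℤ (+ 4)) * π ^ suc k) - 1#) ^ n} half (proj₁ (proj₂ (at k)))))
      (λ k → proj₂ (proj₂ (proj₂ (proj₂ (at k)))))

  -- `B` is the moment sequence of its exponential generating function under `d/dt`. It is exchanged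
  -- for that of the d's under `2M`, which `moments-M` makes explicit.
  qBernoulli-sum : ∀ {q} B d → IsqBernoulli q B → IsdNumbers q d → ∀ n →
    B n ≈ ∑ (suc n) (λ k → fromℚ (fromℤ (+ 2) ℚ-Ops.^ n ℚ.* ℚSeries.w n k ℚ.* -¼ ℚ-Ops.^ k) * d k)
  qBernoulli-sum {q} B d (logq , isLog , s , quotient , expandB) (logq′ , isLog′ , s′ , quotient′ , expandd) n = begin
    B n                                           ≈⟨ moments-egf D-exp 1#-homo B n ⟨
    moments D F n                                 ≈⟨ agree n ⟩
    moments 2M G n                                ≈⟨ moments-scale M-isDerivation two G n ⟩
    two ^ n * moments M G n                       ≈⟨ *-congˡ (moments-M n G) ⟩
    two ^ n * ∑ (suc n) (λ k → w n k * G k)       ≈⟨ ∑-· (suc n) (two ^ n) (λ k → w n k * G k) ⟨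
    ∑ (suc n) (λ k → two ^ n * (w n k * G k))     ≈⟨ ∑-cong (suc n) coefficient ⟩
    ∑ (suc n) (λ k → fromℚ (fromℤ (+ 2) ℚ-Ops.^ n ℚ.* ℚSeries.w n k ℚ.* -¼ ℚ-Ops.^ k) * d k) ∎
    where
    F G : Series
    F n = B n * expSeries n
    G = rescale -¼′ d

    q-1#0 : q - 1# # 0#
    q-1#0 = log-#0 isLog (proj₁ quotient)

    s≈s′ : s ≈ s′
    s≈s′ = quotient-unique (IsSum-unique {λ n → fromℚ (logCoeff n) * (q - 1#) ^ n} isLog isLog′) quotient quotient′

    agree : moments D F ≋ moments 2M G
    -- Both right-hand sides become `(q - 1) · δ ⊕ s · X`: `t` under `D` and `½ log (1 + x)` under
    -- `2M` are the time parameters of their flows.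
    agree = binomial-unique (sym (//-rightDividesˡ 1# q)) (*-cancelˡ-# q-1#0)
      {r = (q - 1#) · δ ⊕ s · X}
      (λ n → trans (moments-functionalEquation D-isDerivation D-exp 1#-homo
                      (qBernoulli-equation B q-1#0 expandB) n)
               (+-congʳ (moments-affine D-isDerivation Dδ≋0 refl DX≋δ (q - 1#) s n)))
      (λ n → trans (moments-functionalEquation 2M-isDerivation 2M-sqrt 1#-homo
                      (dNumbers-equation d q-1#0 expandd) n)
               (+-congʳ (trans
                 (moments-affine 2M-isDerivation 2Mδ≋0 (trans (*-congˡ 0#-homo) (zeroʳ half)) 2M-log (q - 1#) s′ n)
                 (+-congˡ (*-congʳ (sym s≈s′))))))

    coefficient : ∀ k → two ^ n * (w n k * G k)
                      ≈ fromℚ (fromℤ (+ 2) ℚ-Ops.^ n ℚ.* ℚSeries.w n k ℚ.* -¼ ℚ-Ops.^ k) * d k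
    coefficient k = begin
      two ^ n * (w n k * (-¼′ ^ k * d k))
        ≈⟨ solve 4 (λ t w b d → t :* (w :* (b :* d)) := t :* w :* b :* d) refl _ _ _ _ ⟩
      two ^ n * w n k * -¼′ ^ k * d k
        ≈⟨ *-congʳ (*-cong (*-cong (^-homo (fromℤ (+ 2)) n) (w-homo n k)) (^-homo -¼ k)) ⟨
      fromℚ (fromℤ (+ 2) ℚ-Ops.^ n) * fromℚ (ℚSeries.w n k) * fromℚ (-¼ ℚ-Ops.^ k) * d k
        ≈⟨ *-congʳ (trans (*-homo _ _) (*-congʳ (*-homo _ _))) ⟨
      fromℚ (fromℤ (+ 2) ℚ-Ops.^ n ℚ.* ℚSeries.w n k ℚ.* -¼ ℚ-Ops.^ k) * d k ∎

theorem4 : ∀ {c ℓ₁ ℓ₂} (p : ℕ) (pPrime : Prime p) → p ≢ 2 →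
    (cp : PAdicComplexNumbers p c ℓ₁ ℓ₂) →
    let open PAdicAnalysis pPrime cp in
    (q : Carrier) → InDisc (1# - q) →
    (B : ℕ → Carrier) → IsqBernoulli q B →
    (d : ℕ → Carrier) → IsdNumbers q d →
    (S₂ : ℕ → ℕ → ℤ) → IsStirling₂ S₂ →
    ∀ n →
    B n ≈ ∑[ i ≤ n ] (let k = toℕ i in
    fromℚ ((ℚ.- 1ℚ) ℚ-Ops.^ k ℚ.* 2^ (n ⊖ 2 ℕ.* k) ℚ.* fromℤ (+ (k !)) ℚ.* fromℤ (S₂ n k)) * d k)
theorem4 p pPrime p≢2 cp q _ B isqBernoulli d isdNumbers S₂ isStirling n =
  trans (qBernoulli-sum B d isqBernoulli isdNumbers n)
    (sum-cong-≋ {suc n} λ i → *-congʳ {d (toℕ i)} (reflexive (≡.cong fromℚ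
      (≡.sym (stirling₂-coefficient {S₂} isStirling n (Fin.toℕ≤pred[n] i))))))
  where
  open PAdicAnalysis pPrime cp
  open PAdicProperties pPrime p≢2 cp using (qBernoulli-sum)
  open Sum semiring using (sum-cong-≋)
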